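{- For any admissible $v>1$ (that is, any $v>1$ such that a $(K_v,C_4)$-design exists), $$\mathcal{L}_1C_4(v)=\{n\geq v\mid n\equiv 0,1\pmod 3\}$$ and $$\{n\geq v+2\mid n\equiv 0,1\pmod 3\}\subseteq\mathcal{L}_2C_4(v)\subseteq\{n\geq v\mid n\equiv 0,1\pmod 3\}.$$
   Context: Graphs are finite and simple; $\Gamma'\leq\Gamma$ means that $\Gamma'$ is (isomorphic to) a subgraph of $\Gamma$. $K_n$ is the complete graph on $n$ vertices, $C_4$ is the cycle of length $4$, and $P_4$ is the path with $4$ vertices and $3$ edges. For graphs $\Gamma\leq K$, a $(K,\Gamma)$-design is a set of subgraphs of $K$, called blocks, each isomorphic to $\Gamma$, whose edge sets partition $E(K)$. A $(K_v,\Gamma)$-design is also called a $\Gamma$-design of order $v$. Given a $(K,\Gamma)$-design $\mathcal B$ and a $(K',\Gamma')$-design $\mathcal B'$ with $\Gamma'\leq\Gamma$, a down-link from $\mathcal B$ to $\mathcal B'$ is a function $f:\mathcal B\to\mathcal B'$ such that, for every $B\in\mathcal B$, $f(B)$ is a subgraph of $B$ (as an actual graph on the given vertices, not merely up to isomorphism). The complete graphs $K=K_v$ and $K'=K_n$ may have different vertex sets. When such an $f$ exists, $\mathcal B$ is said to be down-linked to $\mathcal B'$. Throughout, the target graph is $\Gamma'=P_4$. $\mathcal{L}_1\Gamma(v)$ is the set of all integers $n$ such that there exists some $\Gamma$-design of order $v$ that can be down-linked to some $P_4$-design of order $n$. $\mathcal{L}_2\Gamma(v)$ is the set of all integers $n$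 such that every $\Gamma$-design of order $v$ can be down-linked to some $P_4$-design of order $n$. Here these are used with $\Gamma=C_4$. -}

module Defs where

open import Data.Fin using (Fin)
open import Data.List using (List; []; _∷_; length; upTo)
open import Data.List.Membership.Propositional using (_∈_)
open import Data.List.Membership.DecPropositional as DecMembership using ()
open import Data.List.Relation.Unary.All as All using (All; all?)
open import Data.List.Relation.Unary.Unique.Propositional using (Unique)
open import Data.List.Relation.Unary.Unique.Propositional.Properties using (upTo⁺)
open import Data.Nat using (ℕ; _≟_; _%_; _≥_)
open import Data.Product using (Σ-syntax; ∃; ∃!; _×_; _,_; proj₁; proj₂)
open import Data.Product.Properties using (≡-dec)
open import Data.Sum as Sum using (_⊎_; inj₁; inj₂)
open import Function.Bundles using (_↔_; _⇔_; Inverse)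
open import Level using (0ℓ; suc)
open import Relation.Binary.Core using (Rel)
open import Relation.Binary.Definitions using (Decidable; Symmetric)
open import Relation.Binary.PropositionalEquality using (_≡_; _≢_; sym)
open import Relation.Nullary.Decidable using (Dec; from-yes; _×-dec_; _⊎-dec_; ¬?)
open import Relation.Unary using (Pred)

open DecMembership _≟_ using (_∈?_)
open DecMembership (≡-dec _≟_ _≟_) using () renaming (_∈?_ to _∈ₑ?_)

-- Finite simple graphs.  Vertices carry labels in ℕ, so that graphs on
-- different (possibly overlapping) vertex sets can be compared literally.
record Graph : Set₁ where
  field
    vertices   : List ℕ
    unique     : Unique vertices
    Adj        : Rel ℕ 0ℓ
    adj?       : Decidable Adj
    adj-sym    : Symmetric Adj
    adj-irrefl : ∀ {x y} → Adj x y → x ≢ y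
    adj-vertex : ∀ {x y} → Adj x y → x ∈ vertices

open Graph public

-- Membership in a duplicate-free list of naturals is proof-irrelevant, so
-- this type has exactly one element per vertex.
V : Graph → Set
V G = ∃ λ x → x ∈ vertices G

infix 4 _⊑_ _≈_ _≅_ _≲_

_⊑_ : Graph → Graph → Set
H ⊑ G = (∀ {x} → x ∈ vertices H → x ∈ vertices G)
      × (∀ {x y} → Adj H x y → Adj G x y)

_≈_ : Graph → Graph → Set
G ≈ H = G ⊑ H × H ⊑ G

record _≅_ (G H : Graph) : Set where
  field
    bijection : V G ↔ V H

  open Inverse bijection public using (to; from)

  field
    preserves : ∀ (x y : V G) →
      Adj G (proj₁ x) (proj₁ y) ⇔ Adj H (proj₁ (to x)) (proj₁ (to y))

_≲_ : Graph → Graph → Set₁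
H ≲ G = ∃ λ S → S ≅ H × S ⊑ G

complete : (xs : List ℕ) → Unique xs → Graph
complete xs u = record
  { vertices   = xs
  ; unique     = u
  ; Adj        = λ x y → x ∈ xs × y ∈ xs × x ≢ y
  ; adj?       = λ x y → (x ∈? xs) ×-dec (y ∈? xs) ×-dec ¬? (x ≟ y)
  ; adj-sym    = λ (p , q , x≢y) → q , p , λ y≡x → x≢y (sym y≡x)
  ; adj-irrefl = λ (_ , _ , x≢y) → x≢y
  ; adj-vertex = proj₁
  }

Valid : ℕ → ℕ × ℕ → Set
Valid n (x , y) = x ∈ upTo n × y ∈ upTo n × x ≢ y

valid? : ∀ n e → Dec (Valid n e)
valid? n (x , y) = (x ∈? upTo n) ×-dec (y ∈? upTo n) ×-dec ¬? (x ≟ y)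

-- The graph on {0,…,n-1} whose edges are the listed pairs, unordered.
fromEdges : (n : ℕ) (es : List (ℕ × ℕ)) → All (Valid n) es → Graph
fromEdges n es ok = record
  { vertices   = upTo n
  ; unique     = upTo⁺ n
  ; Adj        = λ x y → (x , y) ∈ es ⊎ (y , x) ∈ es
  ; adj?       = λ x y → ((x , y) ∈ₑ? es) ⊎-dec ((y , x) ∈ₑ? es)
  ; adj-sym    = Sum.swap
  ; adj-irrefl = λ where
      (inj₁ p) → proj₂ (proj₂ (All.lookup ok p))
      (inj₂ p) x≡y → proj₂ (proj₂ (All.lookup ok p)) (sym x≡y)
  ; adj-vertex = λ where
      (inj₁ p) → proj₁ (All.lookup ok p)
      (inj₂ p) → proj₁ (proj₂ (All.lookup ok p))
  }

C₄ P₄ : Graph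
C₄ = fromEdges 4 es (from-yes (all? (valid? 4) es))
  where es = (0 , 1) ∷ (1 , 2) ∷ (2 , 3) ∷ (3 , 0) ∷ []
P₄ = fromEdges 4 es (from-yes (all? (valid? 4) es))
  where es = (0 , 1) ∷ (1 , 2) ∷ (2 , 3) ∷ []

-- A (K,Γ)-design.  The set of blocks is given by an enumeration without
-- repetition (up to equality of graphs, not isomorphism).  That the blocks'
-- edges lie in K is part of block⊑K.
record Design (K Γ : Graph) : Set₁ where
  field
    Γ≲K       : Γ ≲ K
    size      : ℕ
    block     : Fin size → Graph
    distinct  : ∀ {i j} → block i ≈ block j → i ≡ j
    block⊑K   : ∀ i → block i ⊑ K
    block≅Γ   : ∀ i → block i ≅ Γ
    partition : ∀ {x y} → Adj K x y → ∃! _≡_ λ i → Adj (block i) x y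

record DownLink {K Γ K′ Γ′ : Graph}
                (𝓑 : Design K Γ) (𝓑′ : Design K′ Γ′) : Set₁ where
  private
    module B  = Design 𝓑
    module B′ = Design 𝓑′
  field
    Γ′≲Γ     : Γ′ ≲ Γ
    f        : Fin B.size → Fin B′.size
    subgraph : ∀ i → B′.block (f i) ⊑ B.block i

-- A Γ-design of order v, on an arbitrary set of v points.
record DesignOfOrder (Γ : Graph) (v : ℕ) : Set₁ where
  field
    points        : List ℕ
    points-unique : Unique points
    order         : length points ≡ v
    design        : Design (complete points points-unique) Γ

open DesignOfOrder public using (design)

ℒ₁ : Graph → ℕ → Pred ℕ (suc 0ℓ)
ℒ₁ Γ v n = Σ[ 𝓑 ∈ DesignOfOrder Γ v ] Σ[ 𝓑′ ∈ DesignOfOrder P₄ n ]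
             DownLink (design 𝓑) (design 𝓑′)

ℒ₂ : Graph → ℕ → Pred ℕ (suc 0ℓ)
ℒ₂ Γ v n = ∀ (𝓑 : DesignOfOrder Γ v) → Σ[ 𝓑′ ∈ DesignOfOrder P₄ n ]
             DownLink (design 𝓑) (design 𝓑′)

-- {n ≥ m ∣ n ≡ 0,1 (mod 3)}
AtLeast01Mod3 : ℕ → Pred ℕ 0ℓ
AtLeast01Mod3 m n = n ≥ m × (n % 3 ≡ 0 ⊎ n % 3 ≡ 1)

{-# OPTIONS --safe #-}

-- A down-link cuts one edge out of every 4-cycle, so an order n is attained exactly if the cut edges
-- together with the edges of K_n outside K_v decompose into paths P₄.  Counting edges, and degrees for
-- the parity of v, gives the necessary conditions; each path spans its cycle, hence v ≤ n.
--
-- For an arbitrary C₄-design, split off triples of cycles whose cut edges form a P₄ as long as possible.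
-- A cycle all of whose vertices lie on other remaining cycles is always part of such a triple: cut it
-- at an edge xa, and cut one further cycle at x and one at a.  Otherwise every remaining cycle has a
-- private vertex, and cutting at these leaves a star forest.  The star forest together with all edges
-- at two, three or four new vertices decomposes by combining finitely many small decompositions, and
-- later orders are reached three vertices at a time.
--
-- For n = v and n = v + 1 the cyclic design on ℤ/(8k+1) with base cycles (4i+4, 8i+5, 4i+3, 0), i < k,
-- is cut at its edges of difference 4i+1.  The orbits of three consecutive differences form the
-- translates of one path, so only k mod 3 orbits remain to be treated, with a new vertex if n = v + 1.

module Submission where

open import Defs
open import Algebra.Bundles using (CommutativeMonoid)
import Algebra.Solver.CommutativeMonoid as CommutativeMonoidSolver
open import Data.Bool using (Bool; true; false)
open import Data.Empty using (⊥-elim)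
open import Data.Fin as Fin using (Fin; zero; suc)
open import Data.Fin.Properties using (toℕ-fromℕ<)
open import Data.List using (List; []; _∷_; _++_; [_]; length; map; concatMap; upTo; allFin; lookup; filter; applyUpTo)
open import Data.List.Membership.Propositional using (_∈_; _∉_; find; lose)
open import Data.List.Membership.Propositional.Properties
open import Data.List.Membership.Propositional.Properties.WithK using (unique⇒irrelevant)
open import Data.List.Properties using (++-assoc; ++-identityʳ; concatMap-++; concatMap-map; map-concatMap; map-∘; map-cong; map-++; map-id; map-tabulate; tabulate-lookup; length-++; length-map; length-upTo; filter-none; filter-++; filter-accept; filter-reject)
open import Data.List.Relation.Binary.Disjoint.Propositional using (Disjoint)
open import Data.List.Relation.Binary.Permutation.Propositional using (_↭_; prep; swap; ↭-refl; ↭-reflexive; ↭-sym; ↭-trans; ↭⇒↭ₛ)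
open import Data.List.Relation.Binary.Permutation.Propositional.Properties using (∈-resp-↭; ↭-length; ++⁺ˡ; ++⁺ʳ; ++-comm; shift; shifts; filter-↭; ↭-reverse; ++-commutativeMonoid) renaming (map⁺ to map-↭; ++⁺ to ++-↭)
import Data.List.Relation.Binary.Permutation.Setoid.Properties as PermutationSetoid
open import Data.List.Relation.Unary.All as All using (All; []; _∷_)
import Data.List.Relation.Unary.All.Properties as All
import Data.List.Relation.Unary.AllPairs.Properties as AllPairs
open import Data.List.Relation.Unary.AllPairs as AllPairs using (AllPairs; []; _∷_; allPairs?)
open import Data.List.Relation.Unary.Any as Any using (Any; here; there)
open import Data.List.Relation.Unary.Any.Properties using (lookup-index)
open import Data.List.Relation.Unary.Unique.Propositional using (Unique)
import Data.List.Relation.Unary.Unique.Propositional.Properties as Unique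
open import Data.Nat
open import Data.Nat.DivMod
open import Data.Nat.Divisibility using (_∣_; divides; ∣m+n∣m⇒∣n; ∣m∣n⇒∣m+n; ∣-trans; m∣m*n; m%n≡0⇒n∣m; _∣?_)
open import Data.Nat.ListAction using (sum)
open import Data.Nat.Properties
open import Data.Nat.Tactic.RingSolver using (solve-∀)
open import Data.Product using (Σ-syntax; ∃; ∃₂; _×_; _,_; proj₁; proj₂)
open import Data.Product.Properties using (≡-dec)
open import Data.Sum as Sum using (_⊎_; inj₁; inj₂; [_,_]′)
open import Function using (_∘_; id)
open import Function.Bundles using (mk↔ₛ′; mk⇔; Equivalence; Inverse)
open import Function.Construct.Identity using (↔-id)
open import Relation.Binary.Definitions using (tri<; tri≈; tri>)
open import Relation.Binary.PropositionalEquality hiding ([_])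
open import Relation.Nullary using (¬_; Dec; yes; no; contradiction)
open import Relation.Nullary.Decidable using (map′; from-yes; from-no; True; toWitness; ¬?; decidable-stable; _×-dec_; _⊎-dec_)
open import Relation.Unary using (_≐_; _⊆_)
open import Data.List.Membership.DecPropositional _≟_ using (_∈?_)
open import Data.List.Membership.DecPropositional (≡-dec _≟_ _≟_) using () renaming (_∈?_ to _∈ₑ?_)
open import Data.List.Relation.Unary.Unique.DecPropositional (≡-dec _≟_ _≟_) using () renaming (unique? to uniqueEdges?)

-- Why a star forest helps: the private vertex of a cycle is an end of its cut edge and lies on no
-- other remaining cycle, so these vertices are pairwise distinct and none of them is a centre. Only
-- the centres are out of control, as they may coincide with each other and with any point that is
-- not a leaf; a small decomposition therefore lets a path touch a centre at its first vertex only.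
-- Why finitely many suffice: counting edges forces l ≡ v(v-1)/2 mod 3 for the number l of leaves,
-- and with q = v - l other points only three classes of (l, q) mod 3 survive.
--
-- A nonempty star forest contains no P₄, so this method needs new vertices; hence the special
-- design for the smallest orders. Its base cycles have the differences 1, ..., 4k, each once, and
-- these represent all nonzero differences of ℤ/(8k+1) up to sign.
--
-- Equality of edge sets is a permutation of lists of arcs. It is mostly proved by pigeonhole: a
-- duplicate-free list whose members all occur in a list that is not longer is a permutation of it.

private
  variable
    A B : Set

-- Lists without repetition

Unique-resp-↭ : {xs ys : List A} → xs ↭ ys → Unique xs → Unique ys
Unique-resp-↭ p = PermutationSetoid.Unique-resp-↭ (setoid _) (↭⇒↭ₛ p)

Unique-++⁻ : ∀ (xs : List A) {ys} → Unique (xs ++ ys) → Unique xs × Unique ys × Disjoint xs ys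
Unique-++⁻ [] u = [] , u , λ ()
Unique-++⁻ (x ∷ xs) (x∉ ∷ u) with Unique-++⁻ xs u
... | uˣ , uʸ , xs#ys =
  All.++⁻ˡ xs x∉ ∷ uˣ , uʸ ,
  λ { (here refl , v∈ys) → All.lookup (All.++⁻ʳ xs x∉) v∈ys refl
    ; (there v∈xs , v∈ys) → xs#ys (v∈xs , v∈ys) }

Unique-map-on : {f : A → B} {xs : List A} →
  (∀ {x y} → x ∈ xs → y ∈ xs → f x ≡ f y → x ≡ y) → Unique xs → Unique (map f xs)
Unique-map-on inj [] = []
Unique-map-on inj (x∉ ∷ u) =
  All.map⁺ (All.tabulate λ y∈ fx≡fy → All.lookup x∉ y∈ (inj (here refl) (there y∈) fx≡fy))
  ∷ Unique-map-on (λ x∈ y∈ → inj (there x∈) (there y∈)) u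

Unique-map⇒injective : {f : A → B} {xs : List A} → Unique (map f xs) →
  ∀ {x y} → x ∈ xs → y ∈ xs → f x ≡ f y → x ≡ y
Unique-map⇒injective u (here refl) (here refl) _ = refl
Unique-map⇒injective (y∉ ∷ _) (here refl) (there y∈) eq = contradiction eq (All.lookup y∉ (∈-map⁺ _ y∈))
Unique-map⇒injective (y∉ ∷ _) (there x∈) (here refl) eq = contradiction (sym eq) (All.lookup y∉ (∈-map⁺ _ x∈))
Unique-map⇒injective (_ ∷ u) (there x∈) (there y∈) eq = Unique-map⇒injective u x∈ y∈ eq

Unique-concatMap⁺ : {f : A → List B} {xs : List A} → Unique xs → (∀ x → Unique (f x)) →
  (∀ {x y z} → z ∈ f x → z ∈ f y → x ≡ y) → Unique (concatMap f xs)
Unique-concatMap⁺ [] _ _ = []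
Unique-concatMap⁺ {f = f} (x∉ ∷ u) uf inj = Unique.++⁺ (uf _) (Unique-concatMap⁺ u uf inj)
  λ (z∈ , z∈′) → All.All¬⇒¬Any (All.map (λ x≢y z∈fy → x≢y (inj z∈ z∈fy)) x∉) (∈-concatMap⁻ f z∈′)

Unique-concatMap⇒injective : {f : A → List B} (xs : List A) → Unique (concatMap f xs) →
  ∀ {z} i j → z ∈ f (lookup xs i) → z ∈ f (lookup xs j) → i ≡ j
Unique-concatMap⇒injective (x ∷ xs) u zero zero _ _ = refl
Unique-concatMap⇒injective {f = f} (x ∷ xs) u zero (suc j) z∈ z∈′ =
  ⊥-elim (proj₂ (proj₂ (Unique-++⁻ (f x) u))
      (z∈ , ∈-concatMap⁺ f (Any.map (λ { refl → z∈′ }) (∈-lookup {xs = xs} j))))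
Unique-concatMap⇒injective {f = f} (x ∷ xs) u (suc i) zero z∈ z∈′ =
  ⊥-elim (proj₂ (proj₂ (Unique-++⁻ (f x) u))
      (z∈′ , ∈-concatMap⁺ f (Any.map (λ { refl → z∈ }) (∈-lookup {xs = xs} i))))
Unique-concatMap⇒injective {f = f} (x ∷ xs) u (suc i) (suc j) z∈ z∈′ =
  cong suc (Unique-concatMap⇒injective xs (proj₁ (proj₂ (Unique-++⁻ (f x) u))) i j z∈ z∈′)

Unique⇒complement : {xs ys : List A} → Unique ys → (∀ {z} → z ∈ ys → z ∈ xs) → ∃ λ zs → xs ↭ ys ++ zs
Unique⇒complement {xs = xs} [] _ = xs , ↭-refl
Unique⇒complement {ys = y ∷ ys} (y∉ ∷ u) ys⊆xs with ∈-∃++ (ys⊆xs (here refl))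
... | as , bs , refl =
  let zs , p = Unique⇒complement u ys⊆rest in zs , ↭-trans (shift y as bs) (prep y p)
  where
  ys⊆rest : ∀ {z} → z ∈ ys → z ∈ as ++ bs
  ys⊆rest z∈ with ∈-resp-↭ (shift y as bs) (ys⊆xs (there z∈))
  ... | here refl = contradiction refl (All.lookup y∉ z∈)
  ... | there z∈′ = z∈′

Unique⇒length-mono : {xs ys : List A} → Unique ys → (∀ {z} → z ∈ ys → z ∈ xs) → length ys ≤ length xs
Unique⇒length-mono {ys = ys} u ys⊆xs with Unique⇒complement u ys⊆xs
... | zs , p = subst (length ys ≤_) (sym (trans (↭-length p) (length-++ ys))) (m≤m+n _ _)

-- Pigeonhole: the complement of `ys` in `xs` has length 0. Freedom of `xs` from repetition is a
-- conclusion here, which spares disjointness proofs for families of blocks.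
Unique-covered⇒↭ : {xs ys : List A} → Unique ys → (∀ {z} → z ∈ ys → z ∈ xs) → length xs ≤ length ys → xs ↭ ys
Unique-covered⇒↭ {ys = ys} u ys⊆xs len with Unique⇒complement u ys⊆xs
... | [] , p = ↭-trans p (↭-reflexive (++-identityʳ ys))
... | z ∷ zs , p = contradiction (subst (_≤ length ys) (trans (↭-length p) (length-++ ys)) len)
  (<⇒≱ (m<m+n (length ys) z<s))

Unique⇒↭ : {xs ys : List A} → Unique xs → Unique ys →
  (∀ {z} → z ∈ xs → z ∈ ys) → (∀ {z} → z ∈ ys → z ∈ xs) → xs ↭ ys
Unique⇒↭ uˣ uʸ xs⊆ys ys⊆xs = Unique-covered⇒↭ uʸ ys⊆xs (Unique⇒length-mono uˣ xs⊆ys)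

concatMap-↭ : (f : A → List B) {xs ys : List A} → xs ↭ ys → concatMap f xs ↭ concatMap f ys
concatMap-↭ f _↭_.refl = ↭-refl
concatMap-↭ f (prep x p) = ++⁺ˡ (f x) (concatMap-↭ f p)
concatMap-↭ f (swap {xs} x y p) = ↭-trans (shifts (f x) (f y)) (++⁺ˡ (f y) (++⁺ˡ (f x) (concatMap-↭ f p)))
concatMap-↭ f (_↭_.trans p q) = ↭-trans (concatMap-↭ f p) (concatMap-↭ f q)

-- Edge lists up to orientation and order

Edge : Set
Edge = ℕ × ℕ

bothWays : Edge → List Edge
bothWays (x , y) = (x , y) ∷ (y , x) ∷ []

arcs : List Edge → List Edge
arcs = concatMap bothWays

infix 4 _≋_

-- Equality of multisets of undirected edges: listing both orientations turns it into a permutation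
-- of arcs. Being a record, it lets unification recover E and F, which `arcs` would hide.
record _≋_ (E F : List Edge) : Set where
  constructor mk≋
  field
    arcs-↭ : arcs E ↭ arcs F

open _≋_

arcs-++ : ∀ E F → arcs (E ++ F) ≡ arcs E ++ arcs F
arcs-++ = concatMap-++ bothWays

arcs-concatMap : (f : A → List Edge) (xs : List A) → arcs (concatMap f xs) ≡ concatMap (arcs ∘ f) xs
arcs-concatMap f [] = refl
arcs-concatMap f (x ∷ xs) = trans (arcs-++ (f x) _) (cong (arcs (f x) ++_) (arcs-concatMap f xs))

≋-refl : ∀ {E} → E ≋ E
≋-refl = mk≋ ↭-refl

≋-sym : ∀ {E F} → E ≋ F → F ≋ E
≋-sym (mk≋ p) = mk≋ (↭-sym p)

≋-trans : ∀ {E F G} → E ≋ F → F ≋ G → E ≋ G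
≋-trans (mk≋ p) (mk≋ q) = mk≋ (↭-trans p q)

↭⇒≋ : ∀ {E F} → E ↭ F → E ≋ F
↭⇒≋ p = mk≋ (concatMap-↭ bothWays p)

≡⇒≋ : ∀ {E F} → E ≡ F → E ≋ F
≡⇒≋ refl = ≋-refl

≋-++ : ∀ {E E′ F F′} → E ≋ E′ → F ≋ F′ → E ++ F ≋ E′ ++ F′
≋-++ {E} {E′} {F} {F′} (mk≋ p) (mk≋ q) =
  mk≋ (subst₂ _↭_ (sym (arcs-++ E F)) (sym (arcs-++ E′ F′)) (++-↭ p q))

≋-flip : ∀ {x y E F} → E ≋ F → (x , y) ∷ E ≋ (y , x) ∷ F
≋-flip (mk≋ p) = mk≋ (swap _ _ p)

≋-concatMap : {f g : A → List Edge} → (∀ x → f x ≋ g x) → ∀ xs → concatMap f xs ≋ concatMap g xs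
≋-concatMap f≋g [] = ≋-refl
≋-concatMap f≋g (x ∷ xs) = ≋-++ (f≋g x) (≋-concatMap f≋g xs)

-- Lets the monoid solver carry out the rearrangements of concatenated edge lists.
edgeMonoid : CommutativeMonoid _ _
edgeMonoid = record
  { Carrier = List Edge ; _≈_ = _≋_ ; _∙_ = _++_ ; ε = []
  ; isCommutativeMonoid = record
    { isMonoid = record
      { isSemigroup = record
        { isMagma = record
          { isEquivalence = record { refl = ≋-refl ; sym = ≋-sym ; trans = ≋-trans }
          ; ∙-cong = ≋-++ }
        ; assoc = λ E F G → ≡⇒≋ (++-assoc E F G) }
      ; identity = (λ _ → ≋-refl) , (λ E → ≡⇒≋ (++-identityʳ E)) }
    ; comm = λ E F → ↭⇒≋ (++-comm E F) } }

open CommutativeMonoidSolver edgeMonoid using (solve; _⊕_; _⊜_)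

onEdges : (ℕ → ℕ) → Edge → Edge
onEdges g (x , y) = g x , g y

arcs-map : ∀ g E → arcs (map (onEdges g) E) ≡ map (onEdges g) (arcs E)
arcs-map g [] = refl
arcs-map g (_ ∷ E) = cong (λ F → _ ∷ _ ∷ F) (arcs-map g E)

≋-map : ∀ g {E F} → E ≋ F → map (onEdges g) E ≋ map (onEdges g) F
≋-map g {E} {F} (mk≋ p) =
  mk≋ (subst₂ _↭_ (sym (arcs-map g E)) (sym (arcs-map g F)) (map-↭ (onEdges g) p))

∈-arcs⁻ : ∀ E {x y} → (x , y) ∈ arcs E → (x , y) ∈ E ⊎ (y , x) ∈ E
∈-arcs⁻ (e ∷ E) (here refl) = inj₁ (here refl)
∈-arcs⁻ (e ∷ E) (there (here refl)) = inj₂ (here refl)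
∈-arcs⁻ (e ∷ E) (there (there p)) = Sum.map there there (∈-arcs⁻ E p)

∈-arcs⁺ : ∀ {E x y} → (x , y) ∈ E ⊎ (y , x) ∈ E → (x , y) ∈ arcs E
∈-arcs⁺ (inj₁ (here refl)) = here refl
∈-arcs⁺ (inj₂ (here refl)) = there (here refl)
∈-arcs⁺ (inj₁ (there p)) = there (there (∈-arcs⁺ (inj₁ p)))
∈-arcs⁺ (inj₂ (there p)) = there (there (∈-arcs⁺ (inj₂ p)))

∈-arcs-sym : ∀ {E x y} → (x , y) ∈ arcs E → (y , x) ∈ arcs E
∈-arcs-sym {E} = ∈-arcs⁺ ∘ Sum.swap ∘ ∈-arcs⁻ E

-- The edges of a complete graph

pairs : List ℕ → List Edge
pairs [] = []
pairs (x ∷ xs) = map (x ,_) xs ++ pairs xs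

∈-pairs⁻ : ∀ {xs x y} → Unique xs → (x , y) ∈ pairs xs → x ∈ xs × y ∈ xs × x ≢ y
∈-pairs⁻ {z ∷ xs} (z∉ ∷ u) p with ∈-++⁻ (map (z ,_) xs) p
... | inj₂ q = let x∈ , y∈ , x≢y = ∈-pairs⁻ u q in there x∈ , there y∈ , x≢y
... | inj₁ q with ∈-map⁻ (z ,_) q
...   | _ , y∈ , refl = here refl , there y∈ , All.lookup z∉ y∈

∈-arcs-pairs⁻ : ∀ {xs x y} → Unique xs → (x , y) ∈ arcs (pairs xs) → x ∈ xs × y ∈ xs × x ≢ y
∈-arcs-pairs⁻ {xs} u p with ∈-arcs⁻ (pairs xs) p
... | inj₁ q = ∈-pairs⁻ u q
... | inj₂ q = let y∈ , x∈ , y≢x = ∈-pairs⁻ u q in x∈ , y∈ , ≢-sym y≢x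

∈-pairs⁺ : ∀ {xs x y} → x ∈ xs → y ∈ xs → x ≢ y → (x , y) ∈ pairs xs ⊎ (y , x) ∈ pairs xs
∈-pairs⁺ (here refl) (here refl) x≢y = contradiction refl x≢y
∈-pairs⁺ (here refl) (there y∈) x≢y = inj₁ (∈-++⁺ˡ (∈-map⁺ _ y∈))
∈-pairs⁺ (there x∈) (here refl) x≢y = inj₂ (∈-++⁺ˡ (∈-map⁺ _ x∈))
∈-pairs⁺ {z ∷ xs} (there x∈) (there y∈) x≢y =
  Sum.map (∈-++⁺ʳ (map (z ,_) xs)) (∈-++⁺ʳ (map (z ,_) xs)) (∈-pairs⁺ x∈ y∈ x≢y)

∈-arcs-pairs⁺ : ∀ {xs x y} → x ∈ xs → y ∈ xs → x ≢ y → (x , y) ∈ arcs (pairs xs)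
∈-arcs-pairs⁺ x∈ y∈ x≢y = ∈-arcs⁺ (∈-pairs⁺ x∈ y∈ x≢y)

Unique-arcs-star : ∀ {x} {xs : List ℕ} → All (x ≢_) xs → Unique xs → Unique (arcs (map (x ,_) xs))
Unique-arcs-star [] [] = []
Unique-arcs-star {x} {y ∷ ys} (x≢y ∷ x∉) (y∉ ∷ u) =
  ((λ { refl → x≢y refl }) ∷ All.tabulate λ { z∈ refl → [ absurd₁ , absurd₂ ]′ (∈-arcs⁻ (map (x ,_) ys) z∈) })
  ∷ All.tabulate (λ { z∈ refl → [ absurd₂ , absurd₁ ]′ (∈-arcs⁻ (map (x ,_) ys) z∈) })
  ∷ Unique-arcs-star x∉ u
  where
  absurd₁ : ¬ (x , y) ∈ map (x ,_) ys
  absurd₁ p with ∈-map⁻ (x ,_) p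
  ... | _ , y∈ , refl = All.lookup y∉ y∈ refl
  absurd₂ : ¬ (y , x) ∈ map (x ,_) ys
  absurd₂ p with ∈-map⁻ (x ,_) p
  ... | _ , _ , refl = x≢y refl

Unique-arcs-pairs : ∀ {xs} → Unique xs → Unique (arcs (pairs xs))
Unique-arcs-pairs [] = []
Unique-arcs-pairs {x ∷ xs} (x∉ ∷ u) = subst Unique (sym (arcs-++ (map (x ,_) xs) (pairs xs)))
  (Unique.++⁺ (Unique-arcs-star x∉ u) (Unique-arcs-pairs u) disjoint)
  where
  disjoint : Disjoint (arcs (map (x ,_) xs)) (arcs (pairs xs))
  disjoint (p , q) with ∈-arcs⁻ (map (x ,_) xs) p | ∈-arcs-pairs⁻ u q
  ... | inj₁ r | y∈ , z∈ , _ with ∈-map⁻ (x ,_) r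
  ...   | _ , _ , refl = All.lookup x∉ y∈ refl
  disjoint (p , q) | inj₂ r | y∈ , z∈ , _ with ∈-map⁻ (x ,_) r
  ...   | _ , _ , refl = All.lookup x∉ z∈ refl

-- Copies of a graph on {0,1,2,3}

record Quad : Set where
  constructor quad
  field
    a b c d  : ℕ
    distinct : Unique (a ∷ b ∷ c ∷ d ∷ [])

corners : Quad → List ℕ
corners (quad a b c d _) = a ∷ b ∷ c ∷ d ∷ []

corner : Quad → ℕ → ℕ
corner (quad a b c d _) 0 = a
corner (quad a b c d _) 1 = b
corner (quad a b c d _) 2 = c
corner (quad a b c d _) _ = d

corner-injective : ∀ q {u w} → u ∈ upTo 4 → w ∈ upTo 4 → corner q u ≡ corner q w → u ≡ w
corner-injective q = Unique-map⇒injective (Quad.distinct q)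

-- Shared by C₄ and P₄. The parameter `spanning` rules out isolated vertices, so inclusion of a copy
-- in another graph can be read off its edges.
module Pattern
  (es : List Edge) (ok : All (Valid 4) es)
  (spanning : All (_∈ map proj₁ (arcs es)) (upTo 4)) (simple : Unique (arcs es)) where

  Γ : Graph
  Γ = fromEdges 4 es ok

  edgesOf : Quad → List Edge
  edgesOf q = map (onEdges (corner q)) es

  ∈-edgesOf⁻ : ∀ {q x y} → (x , y) ∈ arcs (edgesOf q) →
    ∃₂ λ u w → (u , w) ∈ arcs es × x ≡ corner q u × y ≡ corner q w
  ∈-edgesOf⁻ {q} p with ∈-map⁻ (onEdges (corner q)) (subst (_ ∈_) (arcs-map (corner q) es) p)
  ... | (u , w) , uw∈ , refl = u , w , uw∈ , refl , refl

  ∈-edgesOf⁺ : ∀ {q u w} → (u , w) ∈ arcs es → (corner q u , corner q w) ∈ arcs (edgesOf q)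
  ∈-edgesOf⁺ {q} p = subst (_ ∈_) (sym (arcs-map (corner q) es)) (∈-map⁺ (onEdges (corner q)) p)

  arc-valid : ∀ {u w} → (u , w) ∈ arcs es → Valid 4 (u , w)
  arc-valid p with ∈-arcs⁻ es p
  ... | inj₁ q = All.lookup ok q
  ... | inj₂ q = let w∈ , u∈ , w≢u = All.lookup ok q in u∈ , w∈ , ≢-sym w≢u

  ∈-edgesOf-corner⁻ : ∀ {q u w} → u ∈ upTo 4 → w ∈ upTo 4 →
    (corner q u , corner q w) ∈ arcs (edgesOf q) → (u , w) ∈ arcs es
  ∈-edgesOf-corner⁻ {q} u∈ w∈ p with ∈-edgesOf⁻ {q} p
  ... | u′ , w′ , p′ , eqᵘ , eqʷ with arc-valid p′
  ...   | u′∈ , w′∈ , _ with corner-injective q u∈ u′∈ eqᵘ | corner-injective q w∈ w′∈ eqʷ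
  ...     | refl | refl = p′

  Unique-arcs-edgesOf : ∀ q → Unique (arcs (edgesOf q))
  Unique-arcs-edgesOf q = subst Unique (sym (arcs-map (corner q) es)) (Unique-map-on injective simple)
    where
    injective : ∀ {e f} → e ∈ arcs es → f ∈ arcs es → onEdges (corner q) e ≡ onEdges (corner q) f → e ≡ f
    injective e∈ f∈ eq with arc-valid e∈ | arc-valid f∈
    ... | x∈ , y∈ , _ | x′∈ , y′∈ , _ =
      cong₂ _,_ (corner-injective q x∈ x′∈ (cong proj₁ eq)) (corner-injective q y∈ y′∈ (cong proj₂ eq))

  copy : Quad → Graph
  copy q = record
    { vertices   = map (corner q) (upTo 4)
    ; unique     = Quad.distinct q
    ; Adj        = λ x y → (x , y) ∈ arcs (edgesOf q)
    ; adj?       = λ x y → (x , y) ∈ₑ? arcs (edgesOf q)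
    ; adj-sym    = ∈-arcs-sym {edgesOf q}
    ; adj-irrefl = irrefl
    ; adj-vertex = vertex }
    where
    irrefl : ∀ {x y} → (x , y) ∈ arcs (edgesOf q) → x ≢ y
    irrefl p x≡y with ∈-edgesOf⁻ {q} p
    ... | u , w , p′ , refl , refl with arc-valid p′
    ...   | u∈ , w∈ , u≢w = u≢w (corner-injective q u∈ w∈ x≡y)
    vertex : ∀ {x y} → (x , y) ∈ arcs (edgesOf q) → x ∈ map (corner q) (upTo 4)
    vertex p with ∈-edgesOf⁻ {q} p
    ... | u , w , p′ , refl , refl = ∈-map⁺ (corner q) (proj₁ (arc-valid p′))

  copy≅Γ : ∀ q → copy q ≅ Γ
  copy≅Γ q = record
    { bijection = mk↔ₛ′ to from to∘from from∘to
    ; preserves = λ x y → mk⇔ (λ p → ∈-arcs⁻ es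
        (∈-edgesOf-corner⁻ {q} (proj₂ (to x)) (proj₂ (to y))
            (subst (_∈ arcs (edgesOf q)) (cong₂ _,_ (to-corner x) (to-corner y)) p)))
                              (λ p → subst (_∈ arcs (edgesOf q)) (sym (cong₂ _,_ (to-corner x) (to-corner y)))
                                  (∈-edgesOf⁺ {q} (∈-arcs⁺ p))) }
    where
    to : V (copy q) → V Γ
    to (x , x∈) = let u , u∈ , _ = ∈-map⁻ (corner q) {xs = upTo 4} x∈ in u , u∈
    to-corner : ∀ x → proj₁ x ≡ corner q (proj₁ (to x))
    to-corner (x , x∈) = proj₂ (proj₂ (∈-map⁻ (corner q) {xs = upTo 4} x∈))
    from : V Γ → V (copy q)
    from (u , u∈) = corner q u , ∈-map⁺ (corner q) u∈
    Σ-≡ : ∀ {xs : List ℕ} → Unique xs → {x y : ∃ (_∈ xs)} → proj₁ x ≡ proj₁ y → x ≡ y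
    Σ-≡ u refl = cong (_ ,_) (unique⇒irrelevant u _ _)
    to∘from : ∀ u → to (from u) ≡ u
    to∘from u = Σ-≡ (unique Γ) (corner-injective q (proj₂ (to (from u))) (proj₂ u) (sym (to-corner (from u))))
    from∘to : ∀ x → from (to x) ≡ x
    from∘to x = Σ-≡ (Quad.distinct q) (sym (to-corner x))

  ⊑-from-Adj : ∀ {q G} → (∀ {x y} → (x , y) ∈ arcs (edgesOf q) → Adj G x y) → copy q ⊑ G
  ⊑-from-Adj {q} {G} adj = vertex , adj
    where
    vertex : ∀ {x} → x ∈ map (corner q) (upTo 4) → x ∈ vertices G
    vertex x∈ with ∈-map⁻ (corner q) x∈
    ... | u , u∈ , refl with ∈-map⁻ proj₁ (All.lookup spanning u∈)
    ...   | (_ , w) , p , refl = adj-vertex G (adj (∈-edgesOf⁺ {q} p))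

  -- A block is only isomorphic to Γ; this is literal agreement with the copy on four named
  -- vertices, after which blocks can be treated as edge lists.
  record Presents (q : Quad) (G : Graph) : Set where
    field
      adj⇒  : ∀ {x y} → Adj G x y → (x , y) ∈ arcs (edgesOf q)
      adj⇐  : ∀ {x y} → (x , y) ∈ arcs (edgesOf q) → Adj G x y
      vert⇒ : ∀ {x} → x ∈ vertices G → x ∈ corners q
      vert⇐ : ∀ {x} → x ∈ corners q → x ∈ vertices G

  present : ∀ {G} → G ≅ Γ → ∃ λ q → Presents q G
  present {G} iso = q , record { adj⇒ = adj⇒ ; adj⇐ = adj⇐ ; vert⇒ = vert⇒ ; vert⇐ = vert⇐ }
    where
    open _≅_ iso
    at : V Γ → ℕ
    at u = proj₁ (from u)
    Σ-≡ : {x y : V G} → proj₁ x ≡ proj₁ y → x ≡ y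
    Σ-≡ refl = cong (_ ,_) (unique⇒irrelevant (unique G) _ _)
    at-injective : ∀ {u w} → at u ≡ at w → u ≡ w
    at-injective {u} {w} eq = trans (sym (Inverse.strictlyInverseˡ bijection u))
      (trans (cong to (Σ-≡ eq)) (Inverse.strictlyInverseˡ bijection w))
    v₀ v₁ v₂ v₃ : V Γ
    v₀ = 0 , here refl
    v₁ = 1 , there (here refl)
    v₂ = 2 , there (there (here refl))
    v₃ = 3 , there (there (there (here refl)))
    vs : List (V Γ)
    vs = v₀ ∷ v₁ ∷ v₂ ∷ v₃ ∷ []
    vs-unique : Unique vs
    vs-unique = ((λ ()) ∷ (λ ()) ∷ (λ ()) ∷ []) ∷ ((λ ()) ∷ (λ ()) ∷ []) ∷ ((λ ()) ∷ []) ∷ [] ∷ []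
    q : Quad
    q = quad (at v₀) (at v₁) (at v₂) (at v₃) (Unique.map⁺ at-injective vs-unique)
    corner-at : ∀ u → corner q (proj₁ u) ≡ at u
    corner-at (_ , here refl) = refl
    corner-at (_ , there (here refl)) = refl
    corner-at (_ , there (there (here refl))) = refl
    corner-at (_ , there (there (there (here refl)))) = refl
    at-to : ∀ x → at (to x) ≡ proj₁ x
    at-to x = cong proj₁ (Inverse.strictlyInverseʳ bijection x)
    corner-to : ∀ x → corner q (proj₁ (to x)) ≡ proj₁ x
    corner-to x = trans (corner-at (to x)) (at-to x)
    adj⇒ : ∀ {x y} → Adj G x y → (x , y) ∈ arcs (edgesOf q)
    adj⇒ {x} {y} p = subst (_∈ arcs (edgesOf q)) (cong₂ _,_ (corner-to X) (corner-to Y))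
        (∈-edgesOf⁺ {q} (∈-arcs⁺ (Equivalence.to (preserves X Y) p)))
      where
      X Y : V G
      X = x , adj-vertex G p
      Y = y , adj-vertex G (adj-sym G p)
    adj⇐ : ∀ {x y} → (x , y) ∈ arcs (edgesOf q) → Adj G x y
    adj⇐ p with ∈-edgesOf⁻ {q} p
    ... | u , w , p′ , refl , refl with arc-valid p′
    ...   | u∈ , w∈ , _ = subst₂ (Adj G) (sym (corner-at U)) (sym (corner-at W))
        (Equivalence.from (preserves (from U) (from W))
          (subst₂ (Adj Γ) (sym (cong proj₁ (Inverse.strictlyInverseˡ bijection U)))
            (sym (cong proj₁ (Inverse.strictlyInverseˡ bijection W))) (∈-arcs⁻ es p′)))
      where
      U W : V Γ
      U = u , u∈
      W = w , w∈
    vert⇒ : ∀ {x} → x ∈ vertices G → x ∈ corners q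
    vert⇒ {x} x∈ = subst (_∈ corners q) (corner-to (x , x∈)) (∈-map⁺ (corner q) (proj₂ (to (x , x∈))))
    vert⇐ : ∀ {x} → x ∈ corners q → x ∈ vertices G
    vert⇐ x∈ with ∈-map⁻ (corner q) x∈
    ... | u , u∈ , refl = subst (_∈ vertices G) (sym (corner-at (u , u∈))) (proj₂ (from (u , u∈)))

  module FromList {xs : List ℕ} (u : Unique xs) (qs : List Quad) (p : pairs xs ≋ concatMap edgesOf qs) where

    K : Graph
    K = complete xs u

    block-arc : ∀ i {e} → e ∈ arcs (edgesOf (lookup qs i)) → e ∈ arcs (pairs xs)
    block-arc i {e} e∈ = ∈-resp-↭ (↭-sym (arcs-↭ p)) (subst (e ∈_) (sym (arcs-concatMap edgesOf qs))
      (∈-concatMap⁺ (arcs ∘ edgesOf) (Any.map (λ { refl → e∈ }) (∈-lookup {xs = qs} i))))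

    arc-block : ∀ {e} → e ∈ arcs (pairs xs) → ∃ λ i → e ∈ arcs (edgesOf (lookup qs i))
    arc-block {e} e∈ with ∈-concatMap⁻ (arcs ∘ edgesOf) {xs = qs}
        (subst (e ∈_) (arcs-concatMap edgesOf qs) (∈-resp-↭ (arcs-↭ p) e∈))
    ... | any = Any.index any , lookup-index any

    block-unique : ∀ i j {e} → e ∈ arcs (edgesOf (lookup qs i)) → e ∈ arcs (edgesOf (lookup qs j)) → i ≡ j
    block-unique i j = Unique-concatMap⇒injective qs (subst Unique (arcs-concatMap edgesOf qs)
      (Unique-resp-↭ (arcs-↭ p) (Unique-arcs-pairs u))) i j

    block⊑K : ∀ i → copy (lookup qs i) ⊑ K
    block⊑K i = ⊑-from-Adj {lookup qs i} {K} (∈-arcs-pairs⁻ u ∘ block-arc i)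

    some-arc : ∃ (_∈ arcs es)
    some-arc = let e , e∈ , _ = ∈-map⁻ proj₁ (All.lookup spanning (here refl)) in e , e∈

    -- The arcs of a complete graph are duplicate-free, so an identity of edge lists already forces
    -- every edge into exactly one block. The index `i₀` supplies the copy of Γ demanded by `Γ≲K`.
    fromList : Fin (length qs) → Design K Γ
    fromList i₀ = record
      { Γ≲K       = copy (lookup qs i₀) , copy≅Γ _ , block⊑K i₀
      ; size      = length qs
      ; block     = copy ∘ lookup qs
      ; distinct  = λ {i} {j} i≈j → block-unique i j (∈-edgesOf⁺ {lookup qs i} (proj₂ some-arc))
                      (proj₂ (proj₁ i≈j) (∈-edgesOf⁺ {lookup qs i} (proj₂ some-arc)))
      ; block⊑K   = block⊑K
      ; block≅Γ   = copy≅Γ ∘ lookup qs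
      ; partition = λ (x∈ , y∈ , x≢y) → let i , e∈ = arc-block (∈-arcs-pairs⁺ x∈ y∈ x≢y) in
                      i , e∈ , block-unique i _ e∈ }

  open FromList public using (fromList)

  module ToList {xs : List ℕ} {u : Unique xs} (𝓑 : Design (complete xs u) Γ) where
    open Design 𝓑

    blockQuad : Fin size → Quad
    blockQuad i = proj₁ (present (block≅Γ i))

    presents : ∀ i → Presents (blockQuad i) (block i)
    presents i = proj₂ (present (block≅Γ i))

    shared-arc : ∀ {i j e} → e ∈ arcs (edgesOf (blockQuad i)) → e ∈ arcs (edgesOf (blockQuad j)) → i ≡ j
    shared-arc {i} {j} e∈ e∈′ =
      let adjⁱ = Presents.adj⇐ (presents i) e∈
          k , _ , k-unique = partition (proj₂ (block⊑K i) adjⁱ)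
      in trans (sym (k-unique adjⁱ)) (k-unique (Presents.adj⇐ (presents j) e∈′))

    -- Both lists of arcs are duplicate-free, the right one because blocks sharing an arc coincide,
    -- and they have the same members by `partition`.
    toList : pairs xs ≋ concatMap (edgesOf ∘ blockQuad) (allFin size)
    toList = mk≋ (subst (arcs (pairs xs) ↭_) (sym (arcs-concatMap (edgesOf ∘ blockQuad) (allFin size)))
      (Unique⇒↭ (Unique-arcs-pairs u)
        (Unique-concatMap⁺ (Unique.allFin⁺ size) (Unique-arcs-edgesOf ∘ blockQuad) shared-arc) pairs⊆ ⊆pairs))
      where
      pairs⊆ : ∀ {e} → e ∈ arcs (pairs xs) → e ∈ concatMap (arcs ∘ edgesOf ∘ blockQuad) (allFin size)
      pairs⊆ e∈ = let i , adjⁱ , _ = partition (∈-arcs-pairs⁻ u e∈) in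
        ∈-concatMap⁺ _ (Any.map (λ { refl → Presents.adj⇒ (presents i) adjⁱ }) (∈-allFin i))
      ⊆pairs : ∀ {e} → e ∈ concatMap (arcs ∘ edgesOf ∘ blockQuad) (allFin size) → e ∈ arcs (pairs xs)
      ⊆pairs e∈ with Any.satisfied (∈-concatMap⁻ _ {xs = allFin size} e∈)
      ... | i , e∈ⁱ = let x∈ , y∈ , x≢y = proj₂ (block⊑K i) (Presents.adj⇐ (presents i) e∈ⁱ) in ∈-arcs-pairs⁺ x∈ y∈ x≢y

-- Four-cycles and paths on four vertices

cycle : List Edge
cycle = (0 , 1) ∷ (1 , 2) ∷ (2 , 3) ∷ (3 , 0) ∷ []

module Cycle = Pattern cycle (from-yes (All.all? (valid? 4) cycle))
  (from-yes (All.all? (_∈? map proj₁ (arcs cycle)) (upTo 4))) (from-yes (uniqueEdges? (arcs cycle)))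

path : List Edge
path = (0 , 1) ∷ (1 , 2) ∷ (2 , 3) ∷ []

module Path = Pattern path (from-yes (All.all? (valid? 4) path))
  (from-yes (All.all? (_∈? map proj₁ (arcs path)) (upTo 4))) (from-yes (uniqueEdges? (arcs path)))

cycleEdges pathEdges : Quad → List Edge
cycleEdges = Cycle.edgesOf
pathEdges = Path.edgesOf

P₄≲C₄ : P₄ ≲ C₄
P₄≲C₄ = P₄ , record { bijection = ↔-id _ ; preserves = λ _ _ → mk⇔ id id } ,
  id , Sum.map ∈-++⁺ˡ ∈-++⁺ˡ

-- Admissible orders

length-arcs : ∀ E → length (arcs E) ≡ 2 * length E
length-arcs [] = refl
length-arcs (_ ∷ E) = trans (cong (2 +_) (length-arcs E)) (double-suc (length E))
  where
  double-suc : ∀ m → 2 + 2 * m ≡ 2 * suc m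
  double-suc = solve-∀

≋-length : ∀ {E F} → E ≋ F → length E ≡ length F
≋-length {E} {F} (mk≋ p) = *-cancelˡ-≡ (length E) (length F) 2
  (trans (sym (length-arcs E)) (trans (↭-length p) (length-arcs F)))

length-concatMap : (f : A → List B) (k : ℕ) → (∀ x → length (f x) ≡ k) → ∀ xs → length
    (concatMap f xs) ≡ length xs * k
length-concatMap f k eq [] = refl
length-concatMap f k eq (x ∷ xs) = trans (length-++ (f x)) (cong₂ _+_ (eq x) (length-concatMap f k eq xs))

-- The binomial coefficient n over 2, with the recursion of `pairs`.
triangle : ℕ → ℕ
triangle zero = 0
triangle (suc n) = n + triangle n

length-pairs : ∀ xs → length (pairs xs) ≡ triangle (length xs)
length-pairs [] = refl
length-pairs (x ∷ xs) = trans (length-++ (map (x ,_) xs)) (cong₂ _+_ (length-map (x ,_) xs) (length-pairs xs))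

triangle-3+ : ∀ n → triangle (3 + n) ≡ 3 * suc n + triangle n
triangle-3+ n = identity n (triangle n)
  where
  identity : ∀ m t → (2 + m) + ((1 + m) + (m + t)) ≡ 3 * suc m + t
  identity = solve-∀

-- The divisibility has period 3 in n by `triangle-3+`, so the values 0, 0, 1 at n = 0, 1, 2 decide.
3∣triangle⇒ : ∀ n → 3 ∣ triangle n → n % 3 ≡ 0 ⊎ n % 3 ≡ 1
3∣triangle⇒ 0 _ = inj₁ refl
3∣triangle⇒ 1 _ = inj₂ refl
3∣triangle⇒ 2 3∣1 = contradiction 3∣1 (from-no (3 ∣? 1))
3∣triangle⇒ (suc (suc (suc n))) 3∣ =
  3∣triangle⇒ n (∣m+n∣m⇒∣n (subst (3 ∣_) (triangle-3+ n) 3∣) (m∣m*n (suc n)))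

triangle-8+ : ∀ n → triangle (8 + n) ≡ 4 * (2 * n + 7) + triangle n
triangle-8+ n = identity n (triangle n)
  where
  identity : ∀ m t → (7 + m) + ((6 + m) +
      ((5 + m) + ((4 + m) + ((3 + m) + ((2 + m) + ((1 + m) + (m + t))))))) ≡ 4 * (2 * m + 7) + t
  identity = solve-∀

4∣triangle⇒ : ∀ n → 4 ∣ triangle n → n % 8 ≡ 0 ⊎ n % 8 ≡ 1
4∣triangle⇒ 0 _ = inj₁ refl
4∣triangle⇒ 1 _ = inj₂ refl
4∣triangle⇒ 2 4∣ = contradiction 4∣ (from-no (4 ∣? 1))
4∣triangle⇒ 3 4∣ = contradiction 4∣ (from-no (4 ∣? 3))
4∣triangle⇒ 4 4∣ = contradiction 4∣ (from-no (4 ∣? 6))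
4∣triangle⇒ 5 4∣ = contradiction 4∣ (from-no (4 ∣? 10))
4∣triangle⇒ 6 4∣ = contradiction 4∣ (from-no (4 ∣? 15))
4∣triangle⇒ 7 4∣ = contradiction 4∣ (from-no (4 ∣? 21))
4∣triangle⇒ (suc (suc (suc (suc (suc (suc (suc (suc n)))))))) 4∣ =
  4∣triangle⇒ n (∣m+n∣m⇒∣n (subst (4 ∣_) (triangle-8+ n) 4∣) (m∣m*n (2 * n + 7)))

P₄-order : ∀ {n} → DesignOfOrder P₄ n → n % 3 ≡ 0 ⊎ n % 3 ≡ 1
P₄-order {n} 𝓑 = 3∣triangle⇒ n (divides (length (allFin size)) (begin
  triangle n                                            ≡⟨ cong triangle order ⟨
  triangle (length points)                              ≡⟨ length-pairs points ⟨
  length (pairs points)                                 ≡⟨ ≋-length toList ⟩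
  length (concatMap (pathEdges ∘ blockQuad) (allFin size)) ≡⟨ length-concatMap _ 3 (λ _ → refl) (allFin size) ⟩
  length (allFin size) * 3                              ∎))
  where
  open ≡-Reasoning
  open DesignOfOrder 𝓑 hiding (design)
  open Design (design 𝓑) using (size)
  open Path.ToList (design 𝓑)

-- Each edge at x contributes exactly one arc starting at x.
degree : ℕ → List Edge → ℕ
degree x E = length (filter (x ≟_) (map proj₁ (arcs E)))

degree-++ : ∀ x E F → degree x (E ++ F) ≡ degree x E + degree x F
degree-++ x E F = begin
  length (filter (x ≟_) (map proj₁ (arcs (E ++ F))))                 ≡⟨ cong (length ∘ filter (x ≟_) ∘ map proj₁)
      (arcs-++ E F) ⟩
  length (filter (x ≟_) (map proj₁ (arcs E ++ arcs F)))              ≡⟨ cong (length ∘ filter (x ≟_))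
      (map-++ proj₁ (arcs E) (arcs F)) ⟩
  length (filter (x ≟_) (map proj₁ (arcs E) ++ map proj₁ (arcs F)))  ≡⟨ cong length
      (filter-++ (x ≟_) (map proj₁ (arcs E)) _) ⟩
  length (filter (x ≟_) (map proj₁ (arcs E)) ++ filter (x ≟_) (map proj₁ (arcs F))) ≡⟨ length-++
      (filter (x ≟_) (map proj₁ (arcs E))) ⟩
  degree x E + degree x F                                            ∎
  where open ≡-Reasoning

degree-≋ : ∀ x {E F} → E ≋ F → degree x E ≡ degree x F
degree-≋ x (mk≋ p) = ↭-length (filter-↭ (x ≟_) (map-↭ proj₁ p))

twice : ℕ → List ℕ
twice y = y ∷ y ∷ []

2∣filter-twice : ∀ x ys → 2 ∣ length (filter (x ≟_) (concatMap twice ys))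
2∣filter-twice x [] = divides 0 refl
2∣filter-twice x (y ∷ ys) with x ≟ y
... | yes refl rewrite filter-accept (x ≟_) {xs = x ∷ concatMap twice ys} refl | filter-accept
    (x ≟_) {xs = concatMap twice ys} refl =
  ∣m∣n⇒∣m+n (divides 1 refl) (2∣filter-twice x ys)
... | no x≢y rewrite filter-reject (x ≟_) {xs = y ∷ concatMap twice ys} x≢y | filter-reject
    (x ≟_) {xs = concatMap twice ys} x≢y =
  2∣filter-twice x ys

-- The eight arcs start at a, b, b, c, c, d, d, a, hence twice at each corner.
2∣degree-cycle : ∀ x q → 2 ∣ degree x (cycleEdges q)
2∣degree-cycle x q@(quad a b c d _) = subst (2 ∣_)
  (↭-length (filter-↭ (x ≟_) (prep a (↭-sym (shift a (b ∷ b ∷ c ∷ c ∷ d ∷ d ∷ []) [])))))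
  (2∣filter-twice x (corners q))

2∣degree-cycles : ∀ x (q : A → Quad) is → 2 ∣ degree x (concatMap (cycleEdges ∘ q) is)
2∣degree-cycles x q [] = divides 0 refl
2∣degree-cycles x q (i ∷ is) = subst (2 ∣_) (sym (degree-++ x (cycleEdges (q i)) (concatMap (cycleEdges ∘ q) is)))
  (∣m∣n⇒∣m+n (2∣degree-cycle x (q i)) (2∣degree-cycles x q is))

degree-star : ∀ {x ys} → All (x ≢_) ys → degree x (map (x ,_) ys) ≡ length ys
degree-star [] = refl
degree-star {x} {y ∷ ys} (x≢y ∷ x∉)
  rewrite filter-accept (x ≟_) {xs = y ∷ map proj₁ (arcs (map (x ,_) ys))} refl
        | filter-reject (x ≟_) {xs = map proj₁ (arcs (map (x ,_) ys))} x≢y = cong suc (degree-star x∉)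

degree-pairs : ∀ {x xs} → Unique (x ∷ xs) → degree x (pairs (x ∷ xs)) ≡ length xs
degree-pairs {x} {xs} (x∉ ∷ u) = begin
  degree x (map (x ,_) xs ++ pairs xs)          ≡⟨ degree-++ x (map (x ,_) xs) (pairs xs) ⟩
  degree x (map (x ,_) xs) + degree x (pairs xs) ≡⟨ cong₂ _+_ (degree-star x∉)
      (cong length (filter-none (x ≟_) absent)) ⟩
  length xs + 0                                 ≡⟨ +-identityʳ _ ⟩
  length xs                                     ∎
  where
  open ≡-Reasoning
  absent : All (x ≢_) (map proj₁ (arcs (pairs xs)))
  absent = All.map⁺ (All.tabulate λ e∈ → All.lookup x∉ (proj₁ (∈-arcs-pairs⁻ u e∈)))

-- Counting edges leaves v ≡ 0 or 1 mod 8. The case 0 falls to parity: the degree v - 1 of a point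
-- is a sum of even degrees.
C₄-order : ∀ {v} → v > 0 → DesignOfOrder C₄ v → v % 8 ≡ 1
C₄-order v>0 record { points = [] ; order = refl } = contradiction v>0 λ ()
C₄-order _ record { points = x ∷ xs ; points-unique = u ; order = refl ; design = 𝓑 } =
  [ (λ v%8≡0 → contradiction (even v%8≡0) (from-no (2 ∣? 1))) , id ]′
      (4∣triangle⇒ (suc (length xs)) (divides (length (allFin size)) (begin
    triangle (suc (length xs))                               ≡⟨ length-pairs (x ∷ xs) ⟨
    length (pairs (x ∷ xs))                                  ≡⟨ ≋-length toList ⟩
    length (concatMap (cycleEdges ∘ blockQuad) (allFin size)) ≡⟨ length-concatMap _ 4 (λ _ → refl) (allFin size) ⟩
    length (allFin size) * 4                                 ∎)))
  where
  open ≡-Reasoning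
  open Design 𝓑 using (size)
  open Cycle.ToList 𝓑
  2∣degree : 2 ∣ length xs
  2∣degree = subst (2 ∣_) (trans (degree-≋ x (≋-sym toList)) (degree-pairs u))
      (2∣degree-cycles x blockQuad (allFin size))
  even : suc (length xs) % 8 ≡ 0 → 2 ∣ 1
  even v%8≡0 = ∣m+n∣m⇒∣n (subst (2 ∣_) (+-comm 1 (length xs))
    (∣-trans (divides 4 refl) (m%n≡0⇒n∣m (suc (length xs)) 8 v%8≡0))) 2∣degree

-- Down-links

-- This is where v > 1 enters: a point with a partner lies on an edge, hence on a block.
another : ∀ {xs : List ℕ} → Unique xs → length xs > 1 → ∀ x → ∃ λ y → y ∈ xs × x ≢ y
another {y ∷ []} _ (s≤s ()) _
another {y ∷ z ∷ _} ((y≢z ∷ _) ∷ _) _ x with x ≟ y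
... | yes refl = z , there (here refl) , y≢z
... | no x≢y = y , here refl , x≢y

downLink⇒≤ : ∀ {v n} → v > 1 → (𝓑 : DesignOfOrder C₄ v) (𝓑′ : DesignOfOrder P₄ n) →
  DownLink (design 𝓑) (design 𝓑′) → v ≤ n
downLink⇒≤ v>1 𝓑 𝓑′ link = subst₂ _≤_ (DesignOfOrder.order 𝓑) (DesignOfOrder.order 𝓑′)
  (Unique⇒length-mono (DesignOfOrder.points-unique 𝓑) points⊆)
  where
  module B = Design (design 𝓑)
  module B′ = Design (design 𝓑′)
  module C = Cycle.ToList (design 𝓑)
  module P = Path.ToList (design 𝓑′)
  open DownLink link
  -- The path f i spans the cycle block i, having as many vertices.
  spans : ∀ {i x} → x ∈ vertices (B.block i) → x ∈ vertices (B′.block (f i))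
  spans {i} x∈ = Path.Presents.vert⇐ (P.presents (f i))
    (∈-resp-↭ (Unique-covered⇒↭ (Quad.distinct (P.blockQuad (f i)))
      (Cycle.Presents.vert⇒ (C.presents i) ∘ proj₁ (subgraph i) ∘ Path.Presents.vert⇐ (P.presents (f i))) ≤-refl)
      (Cycle.Presents.vert⇒ (C.presents i) x∈))
  points⊆ : ∀ {x} → x ∈ DesignOfOrder.points 𝓑 → x ∈ DesignOfOrder.points 𝓑′
  points⊆ {x} x∈ =
    let y , y∈ , x≢y = another (DesignOfOrder.points-unique 𝓑) (subst (_> 1) (sym (DesignOfOrder.order 𝓑)) v>1) x
        i , adj , _ = B.partition (x∈ , y∈ , x≢y)
    in proj₁ (B′.block⊑K (f i)) (spans (adj-vertex (B.block i) adj))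

cutEdge : Quad → Edge
cutEdge (quad a b c d _) = a , b

-- Both leave the cycle unchanged. `reflect` keeps the first corner and exchanges its two
-- neighbours, which gives the second choice of a cut edge at that corner.
rotate reflect : Quad → Quad
rotate (quad a b c d u) = quad b c d a (Unique-resp-↭ (↭-sym (shift a (b ∷ c ∷ d ∷ []) [])) u)
reflect (quad a b c d u) = quad a d c b (Unique-resp-↭ (prep a (↭-sym (↭-reverse (b ∷ c ∷ d ∷ [])))) u)

-- A cycle of the family q, written so that the edge removed from it comes first.
record Cut {s : ℕ} (q : Fin s → Quad) : Set where
  constructor cut
  field
    index   : Fin s
    rotated : Quad
    same    : cycleEdges rotated ≋ cycleEdges (q index)

  -- For a cycle a b c d cut at a b this is the path b c d a.
  kept : Quad
  kept = rotate rotated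

open Cut using (index; rotated; kept)

-- The paths `qs` left over from the cycles are prescribed as blocks; this is what yields a
-- down-link and not just a P₄-design.
CompletedBy : List Quad → List ℕ → Set
CompletedBy qs U = ∃ λ ps → pairs U ≋ concatMap pathEdges (qs ++ ps)

∈⇒lookup : {x : A} {xs : List A} → x ∈ xs → ∃ λ i → lookup xs i ≡ x
∈⇒lookup x∈ = Any.index x∈ , sym (lookup-index x∈)

locate : ∀ {s} {q : Fin s → Quad} (cs : List (Cut q)) ps {i} → i ∈ map index cs →
  ∃ λ j → Σ[ c ∈ Cut q ] i ≡ index c × lookup (map kept cs ++ ps) j ≡ kept c
locate cs ps i∈ with ∈-map⁻ index i∈
... | c , c∈ , i≡ = let j , eq = ∈⇒lookup (∈-++⁺ˡ {ys = ps} (∈-map⁺ kept c∈)) in j , c , i≡ , eq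

assemble : ∀ {v n} (𝓑 : DesignOfOrder C₄ v) → let open Cycle.ToList (design 𝓑) in
  (cs : List (Cut blockQuad)) → (∀ i → i ∈ map index cs) →
  (U : List ℕ) → Unique U → length U ≡ n → n > 1 →
  CompletedBy (map kept cs) U →
  Σ[ 𝓑′ ∈ DesignOfOrder P₄ n ] DownLink (design 𝓑) (design 𝓑′)
assemble 𝓑 cs all (_ ∷ []) u refl (s≤s ()) (ps , p)
assemble 𝓑 cs all U@(x ∷ y ∷ _) u@((x≢y ∷ _) ∷ _) refl n>1 (ps , p) = 𝓑′ , record
  { Γ′≲Γ = P₄≲C₄
  ; f = proj₁ ∘ target
  ; subgraph = λ i → Path.⊑-from-Adj {lookup paths (proj₁ (target i))} {block i}
      (let _ , c , i≡ , eq = target i in cut-adj c i≡ eq) }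
  where
  open Design (design 𝓑) using (block)
  open Cycle.ToList (design 𝓑)
  paths : List Quad
  paths = map kept cs ++ ps
  module L = Path.FromList u paths p
  i₀ : Fin (length paths)
  i₀ = proj₁ (L.arc-block (∈-arcs-pairs⁺ {U} (here refl) (there (here refl)) x≢y))
  𝓑′ : DesignOfOrder P₄ (length U)
  𝓑′ = record { points = U ; points-unique = u ; order = refl ; design = Path.fromList u paths p i₀ }
  target : ∀ i → ∃ λ j → Σ[ c ∈ Cut blockQuad ] i ≡ index c × lookup paths j ≡ kept c
  target i = locate cs ps (all i)
  cut-adj : ∀ {i j x y} (c : Cut blockQuad) → i ≡ index c → lookup paths j ≡ kept c →
    (x , y) ∈ arcs (pathEdges (lookup paths j)) → Adj (block i) x y
  cut-adj {x = x} {y} (cut _ r r≋) refl eq e∈ = Cycle.Presents.adj⇐ (presents _)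
    -- The two arcs of the cut edge head the arcs of the cycle; the arcs of the kept path are the
    -- remainder.
    (∈-resp-↭ (arcs-↭ r≋) (there (there (subst (λ q → (x , y) ∈ arcs (pathEdges q)) eq e∈))))

-- Cutting one edge out of every cycle

cycle-rotate : ∀ r → cycleEdges (rotate r) ≋ cycleEdges r
cycle-rotate (quad a b c d _) = ↭⇒≋ (shift (a , b) ((b , c) ∷ (c , d) ∷ (d , a) ∷ []) [])

cycle-reflect : ∀ r → cycleEdges (reflect r) ≋ cycleEdges r
cycle-reflect (quad a b c d _) = ≋-trans (≋-flip (≋-flip (≋-flip (≋-flip ≋-refl))))
  (↭⇒≋ (↭-reverse ((a , b) ∷ (b , c) ∷ (c , d) ∷ (d , a) ∷ [])))

corners-arc : ∀ r {x} → x ∈ corners r → ∃ λ y → (x , y) ∈ arcs (cycleEdges r)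
corners-arc r (here refl) = _ , here refl
corners-arc r (there (here refl)) = _ , there (here refl)
corners-arc r (there (there (here refl))) = _ , there (there (there (here refl)))
corners-arc r (there (there (there (here refl)))) = _ , there (there (there (there (there (here refl)))))

arc-corners : ∀ r {x y} → (x , y) ∈ arcs (cycleEdges r) → x ∈ corners r
arc-corners r p with Cycle.∈-edgesOf⁻ {r} p
... | u , w , p′ , refl , refl = ∈-map⁺ (corner r) (proj₁ (Cycle.arc-valid p′))

cycle-corners : ∀ {r r′ x} → cycleEdges r ≋ cycleEdges r′ → x ∈ corners r → x ∈ corners r′
cycle-corners {r} {r′} p x∈ = arc-corners r′ (∈-resp-↭ (arcs-↭ p) (proj₂ (corners-arc r x∈)))

startAt : ∀ r {x} → x ∈ corners r → ∃ λ r′ → cycleEdges r′ ≋ cycleEdges r × Quad.a r′ ≡ x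
startAt r (here refl) = r , ≋-refl , refl
startAt r (there (here refl)) = rotate r , cycle-rotate r , refl
startAt r (there (there (here refl))) = rotate (rotate r) , ≋-trans (cycle-rotate (rotate r)) (cycle-rotate r) ,
    refl
startAt r (there (there (there (here refl)))) = rotate (rotate (rotate r)) ,
  ≋-trans (cycle-rotate (rotate (rotate r))) (≋-trans (cycle-rotate (rotate r)) (cycle-rotate r)) , refl

edge : {s : ℕ} {q : Fin s → Quad} → Cut q → Edge
edge = cutEdge ∘ rotated

-- The cut edges of stars form a star forest: the first corner of each member is a leaf.
record StarForest (stars : List Quad) : Set where
  field
    leaves-unique  : Unique (map Quad.a stars)
    leaves-private : ∀ {r r′} → r ∈ stars → r′ ∈ stars → Quad.a r ∉ (Quad.b r′ ∷ Quad.c r′ ∷ Quad.d r′ ∷ [])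

module Cutting {s : ℕ} (q : Fin s → Quad)
  (shared-arc : ∀ {i j e} → e ∈ arcs (cycleEdges (q i)) → e ∈ arcs (cycleEdges (q j)) → i ≡ j) where

  cut-arc : (c : Cut q) → ∀ {e} → e ∈ arcs (cycleEdges (rotated c)) → e ∈ arcs (cycleEdges (q (index c)))
  cut-arc (cut i r p) = ∈-resp-↭ (arcs-↭ p)

  cuts-shared-arc : (c c′ : Cut q) → ∀ {e} → e ∈ arcs (cycleEdges (rotated c)) → e ∈ arcs
      (cycleEdges (rotated c′)) → index c ≡ index c′
  cuts-shared-arc c c′ e∈ e∈′ = shared-arc (cut-arc c e∈) (cut-arc c′ e∈′)

  -- The edges x a, x b, a y form the path y a x b as soon as y and b differ: y = x or a = b would
  -- put the edge x a on two different cycles.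
  rainbow₀ : (c c′ c″ : Cut q) → index c ≢ index c′ → index c ≢ index c″ →
    Quad.a (rotated c) ≡ Quad.a (rotated c′) → Quad.b (rotated c) ≡ Quad.a (rotated c″) →
    Quad.b (rotated c″) ≢ Quad.b (rotated c′) →
    ∃ λ p → pathEdges p ≋ edge c ∷ edge c′ ∷ edge c″ ∷ []
  rainbow₀ c@(cut _ (quad x a _ _ ((x≢a ∷ _) ∷ _)) _) c′@(cut _ (quad _ b _ _ ((x≢b ∷ _) ∷ _)) _)
    c″@(cut _ (quad _ y _ _ ((a≢y ∷ _) ∷ _)) _) c≢c′ c≢c″ refl refl y≢b =
    quad y a x b ((≢-sym a≢y ∷ y≢x ∷ y≢b ∷ []) ∷ (≢-sym x≢a ∷ a≢b ∷ []) ∷ (x≢b ∷ []) ∷ [] ∷ []) ,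
    ≋-trans (≋-flip (≋-flip ≋-refl)) (↭⇒≋ (↭-trans (swap _ _ ↭-refl) (prep _ (swap _ _ ↭-refl))))
    where
    y≢x : y ≢ x
    y≢x refl = c≢c″ (cuts-shared-arc c c″ (here refl) (there (here refl)))
    a≢b : a ≢ b
    a≢b refl = c≢c′ (cuts-shared-arc c c′ (here refl) (here refl))

  Rainbow : (i j k : Fin s) → Set
  Rainbow i j k = Σ[ c ∈ Cut q ] Σ[ c′ ∈ Cut q ] Σ[ c″ ∈ Cut q ] Σ[ p ∈ Quad ]
    index c ≡ i × index c′ ≡ j × index c″ ≡ k × pathEdges p ≋ edge c ∷ edge c′ ∷ edge c″ ∷ []

  -- If the outer ends of the edges chosen on cycles j and k meet, cycle k is cut at its other edge
  -- through the same corner instead.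
  rainbow : ∀ r {i j k} → cycleEdges r ≋ cycleEdges (q i) → i ≢ j → i ≢ k →
    Quad.a r ∈ corners (q j) → Quad.b r ∈ corners (q k) → Rainbow i j k
  rainbow r {i} {j} {k} r≋ i≢j i≢k x∈ a∈ with startAt (q j) x∈ | startAt (q k) a∈
  ... | r′ , r′≋ , eq′ | r″ , r″≋ , eq″ with Quad.b r″ ≟ Quad.b r′
  ...   | no y≢b = cut i r r≋ , cut j r′ r′≋ , cut k r″ r″≋ ,
    let p , p≋ = rainbow₀ (cut i r r≋) (cut j r′ r′≋) (cut k r″ r″≋) i≢j i≢k (sym eq′) (sym eq″) y≢b in
    p , refl , refl , refl , p≋
  ...   | yes y≡b = cut i r r≋ , cut j r′ r′≋ , cut k (reflect r″) r‴≋ ,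
    let p , p≋ = rainbow₀ (cut i r r≋) (cut j r′ r′≋) (cut k (reflect r″) r‴≋) i≢j i≢k (sym eq′) (sym eq″)
                   (λ d≡b → b≢d r″ (trans y≡b (sym d≡b))) in
    p , refl , refl , refl , p≋
    where
    r‴≋ : cycleEdges (reflect r″) ≋ cycleEdges (q k)
    r‴≋ = ≋-trans (cycle-reflect r″) r″≋
    b≢d : ∀ r → Quad.b r ≢ Quad.d r
    b≢d (quad _ _ _ _ (_ ∷ (_ ∷ b≢d ∷ []) ∷ _)) = b≢d

  -- Cycle j has a(r) and b(r) opposite to each other, as it does not contain the edges of cycle i;
  -- likewise a(r) and d(r), but a(r) has only one opposite corner.
  opposite : ∀ {i j} r → cycleEdges r ≋ cycleEdges (q i) → i ≢ j →
    Quad.a r ∈ corners (q j) → Quad.b r ∈ corners (q j) → Quad.d r ∉ corners (q j)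
  opposite {i} {j} r@(quad x a _ c ((_ ∷ _ ∷ x≢c ∷ []) ∷ (_ ∷ a≢c ∷ []) ∷ _)) r≋ i≢j x∈ a∈ c∈
    with startAt (q j) x∈
  ... | r′@(quad x′ b e d _) , r′≋ , refl
    with cycle-corners {q j} {r′} (≋-sym r′≋) a∈ | cycle-corners {q j} {r′} (≋-sym r′≋) c∈
  ... | here refl | _ = contradiction refl (first≢second r)
    where
    first≢second : ∀ r → Quad.a r ≢ Quad.b r
    first≢second (quad _ _ _ _ ((a≢b ∷ _) ∷ _)) = a≢b
  ... | there (here refl) | _ = i≢j (cuts-shared-arc (cut i r r≋) (cut j r′ r′≋) (here refl) (here refl))
  ... | there (there (there (here refl))) | _ = i≢j
      (cuts-shared-arc (cut i r r≋) (cut j r′ r′≋) (here refl)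
          (there (there (there (there (there (there (there (here refl)))))))))
  ... | there (there (here refl)) | here refl = x≢c refl
  ... | there (there (here refl)) | there (here refl) = i≢j
      (cuts-shared-arc (cut i r r≋) (cut j r′ r′≋)
          (there (there (there (there (there (there (there (here refl)))))))) (here refl))
  ... | there (there (here refl)) | there (there (here refl)) = a≢c refl
  ... | there (there (here refl)) | there (there (there (here refl))) = i≢j
      (cuts-shared-arc (cut i r r≋) (cut j r′ r′≋)
    (there (there (there (there (there (there (there (here refl))))))))
        (there (there (there (there (there (there (there (here refl)))))))))

  PrivateIn : List (Fin s) → Fin s → ℕ → Set
  PrivateIn R i x = All (λ j → j ≡ i ⊎ x ∉ corners (q j)) R

  privateIn? : ∀ R i x → Dec (PrivateIn R i x)
  privateIn? R i x = All.all? (λ j → (j Fin.≟ i) ⊎-dec ¬? (x ∈? corners (q j))) R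

  HasPrivate : List (Fin s) → Fin s → Set
  HasPrivate R i = Any (PrivateIn R i) (corners (q i))

  hasPrivate? : ∀ R i → Dec (HasPrivate R i)
  hasPrivate? R i = Any.any? (privateIn? R i) (corners (q i))

  meets : ∀ {R i x} → ¬ HasPrivate R i → x ∈ corners (q i) → ∃ λ j → j ∈ R × i ≢ j × x ∈ corners (q j)
  meets {R} {i} {x} ¬private x∈ with find (All.¬All⇒Any¬ (λ j → (j Fin.≟ i) ⊎-dec ¬? (x ∈? corners (q j))) R
    (λ p → ¬private (lose x∈ p)))
  ... | j , j∈ , ¬p = j , j∈ , (λ i≡j → ¬p (inj₁ (sym i≡j))) , decidable-stable (x ∈? corners (q j)) (¬p ∘ inj₂)

  -- Let j, k, l be further cycles through the corners a, b, d of cycle i. Then j ≠ k gives a path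
  -- through the edge a b, j ≠ l one through a d, and j = k = l is impossible by `opposite`.
  rainbowIn : ∀ {R i} → ¬ HasPrivate R i → ∃₂ λ j k → j ∈ R × k ∈ R × i ≢ j × i ≢ k × j ≢ k × Rainbow i j k
  rainbowIn {R} {i} ¬private
    with meets ¬private (here refl) | meets ¬private (there (here refl)) | meets ¬private
        (there (there (there (here refl))))
  ... | j , j∈ , i≢j , x∈ | k , k∈ , i≢k , a∈ | l , l∈ , i≢l , c∈ with j Fin.≟ k | j Fin.≟ l
  ...   | no j≢k   | _        = j , k , j∈ , k∈ , i≢j , i≢k , j≢k , rainbow (q i) ≋-refl i≢j i≢k x∈ a∈
  ...   | yes refl | no j≢l   = j , l , j∈ , l∈ , i≢j , i≢l , j≢l , rainbow (reflect (q i))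
      (cycle-reflect (q i)) i≢j i≢l x∈ c∈
  ...   | yes refl | yes refl = contradiction c∈ (opposite (q i) ≋-refl i≢j x∈ a∈)

  record Cutting (R : List (Fin s)) : Set where
    field
      cuts    : List (Cut q)
      indices : map index cuts ↭ R
      paths   : List Quad
      stars   : List Quad
      split   : map edge cuts ≋ concatMap pathEdges paths ++ map cutEdge stars
      forest  : StarForest stars
      origin  : ∀ {r} → r ∈ stars → ∃ λ i → cycleEdges r ≋ cycleEdges (q i)

  -- Total in i, so that it can be mapped over any list; a cycle without a private vertex gets an
  -- arbitrary starting corner.
  privateCut : ∀ R i → ∃ λ r → cycleEdges r ≋ cycleEdges (q i) × (HasPrivate R i → PrivateIn R i (Quad.a r))
  privateCut R i with hasPrivate? R i
  ... | no ¬p = q i , ≋-refl , λ p → contradiction p ¬p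
  ... | yes p with find p
  ...   | x , x∈ , px with startAt (q i) x∈
  ...     | r , r≋ , refl = r , r≋ , λ _ → px

  -- A leaf lying on the star quad of j forces j to be its own cycle. This gives both that leaves
  -- are distinct and that no leaf is a centre.
  starCutting : ∀ {R} → Unique R → All (HasPrivate R) R → Cutting R
  starCutting {R} u private-R = record
    { cuts = map (λ i → cut i (star i) (star≋ i)) R
    ; indices = ↭-reflexive (trans (sym (map-∘ R)) (map-id R))
    ; paths = []
    ; stars = map star R
    ; split = ≡⇒≋ (trans (sym (map-∘ R)) (map-∘ R))
    ; forest = record
      { leaves-unique = subst Unique (map-∘ R) (Unique-map-on leaf-injective u)
      ; leaves-private = leaves-private }
    ; origin = λ r∈ → let i , _ , r≡ = ∈-map⁻ star r∈ in i , subst (λ r → cycleEdges r ≋ cycleEdges (q i)) (sym r≡) (star≋ i) }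
    where
    star : Fin s → Quad
    star i = proj₁ (privateCut R i)
    star≋ : ∀ i → cycleEdges (star i) ≋ cycleEdges (q i)
    star≋ i = proj₁ (proj₂ (privateCut R i))
    only : ∀ {i j} → i ∈ R → j ∈ R → Quad.a (star i) ∈ corners (star j) → j ≡ i
    only {i} {j} i∈ j∈ p with All.lookup (proj₂ (proj₂ (privateCut R i)) (All.lookup private-R i∈)) j∈
    ... | inj₁ j≡i = j≡i
    ... | inj₂ ∉j = contradiction (cycle-corners {star j} {q j} (star≋ j) p) ∉j
    leaf-injective : ∀ {i j} → i ∈ R → j ∈ R → Quad.a (star i) ≡ Quad.a (star j) → i ≡ j
    leaf-injective i∈ j∈ eq = sym (only i∈ j∈ (here eq))
    leaves-private : ∀ {r r′} → r ∈ map star R → r′ ∈ map star R → Quad.a r ∉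
        (Quad.b r′ ∷ Quad.c r′ ∷ Quad.d r′ ∷ [])
    leaves-private r∈ r′∈ p with ∈-map⁻ star r∈ | ∈-map⁻ star r′∈
    ... | i , i∈ , refl | j , j∈ , refl with only i∈ j∈ (there p)
    ...   | refl with Quad.distinct (star i)
    ...     | a∉ ∷ _ = All.lookup a∉ p refl

  peel : ∀ {R i j k R′} → R ↭ i ∷ j ∷ k ∷ R′ → Rainbow i j k → Cutting R′ → Cutting R
  peel R↭ (c , c′ , c″ , p , refl , refl , refl , p≋) rest = record
    { cuts = c ∷ c′ ∷ c″ ∷ cuts
    ; indices = ↭-trans (prep _ (prep _ (prep _ indices))) (↭-sym R↭)
    ; paths = p ∷ paths
    ; stars = stars
    ; split = ≋-trans (≋-++ (≋-sym p≋) split) (≡⇒≋ (sym (++-assoc (pathEdges p) (concatMap pathEdges paths) _)))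
    ; forest = forest
    ; origin = origin }
    where open Cutting rest

  -- The bound n makes the recursion structural. After a peeling all remaining cycles are tested
  -- anew, since removing cycles can make vertices private.
  cutting : ∀ n R → length R ≤ n → Unique R → Cutting R
  cutting zero [] _ u = starCutting u []
  cutting (suc n) R len u with All.all? (hasPrivate? R) R
  ... | yes private-R = starCutting u private-R
  ... | no ¬private with find (All.¬All⇒Any¬ (hasPrivate? R) R ¬private)
  ...   | i , i∈ , ¬p with rainbowIn ¬p
  ...     | j , k , j∈ , k∈ , i≢j , i≢k , j≢k , ijk
    with Unique⇒complement {xs = R} ((i≢j ∷ i≢k ∷ []) ∷ (j≢k ∷ []) ∷ [] ∷ [])
      (λ { (here refl) → i∈ ; (there (here refl)) → j∈ ; (there (there (here refl))) → k∈ })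
  ...       | R′ , R↭ = peel R↭ ijk (cutting n R′
    (≤-trans (m≤n+m (length R′) 2) (≤-pred (subst (_≤ suc n) (↭-length R↭) len)))
    (proj₁ (proj₂ (Unique-++⁻ (i ∷ j ∷ k ∷ []) (Unique-resp-↭ R↭ u)))))

-- Decomposing a star forest joined to a few new vertices

Decomposable : List Edge → Set
Decomposable E = ∃ λ ps → E ≋ concatMap pathEdges ps

Decomposable-≋ : ∀ {E F} → E ≋ F → Decomposable F → Decomposable E
Decomposable-≋ E≋F (ps , F≋) = ps , ≋-trans E≋F F≋

Decomposable-++ : ∀ {E F} → Decomposable E → Decomposable F → Decomposable (E ++ F)
Decomposable-++ (ps , E≋) (qs , F≋) = ps ++ qs , ≋-trans (≋-++ E≋ F≋) (≡⇒≋ (sym (concatMap-++ pathEdges ps qs)))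

join : List ℕ → List ℕ → List Edge
join W = concatMap (λ x → map (_, x) W)

-- The edges from W to the centre h are left out, as several leaves may share h; they belong to the
-- `join` part.
claw : List ℕ → Edge → List Edge
claw W (p , h) = (p , h) ∷ map (_, p) W

-- The leaves come with the centre they are attached to.
forestJoin : List ℕ → List Edge → List ℕ → List Edge
forestJoin W ls qs = concatMap (claw W) ls ++ join W qs

-- When extensions over the same W are added up, only one of them may use the edges inside W; the
-- flag marks that one.
clique : Bool → List ℕ → List Edge
clique true  W = pairs W
clique false W = []

extension : Bool → List ℕ → List Edge → List ℕ → List Edge
extension b W ls qs = clique b W ++ forestJoin W ls qs

record Good (W : List ℕ) (ls : List Edge) (qs : List ℕ) : Set where
  core : List ℕ
  core = W ++ map proj₁ ls
  base : List ℕ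
  base = core ++ qs
  field
    base-unique : Unique base
    centres     : All (_∉ core) (map proj₂ ls)

-- Small decompositions as numbered templates

at : List ℕ → ℕ → ℕ
-- A default value; the indices in a valid template stay in range.
at [] _ = 0
at (x ∷ xs) zero = x
at (x ∷ xs) (suc i) = at xs i

at-∈ : ∀ xs {i} → i < length xs → at xs i ∈ xs
at-∈ (x ∷ xs) {zero} _ = here refl
at-∈ (x ∷ xs) {suc i} (s≤s i<) = there (at-∈ xs i<)

at-++ˡ : ∀ xs {ys i} → i < length xs → at (xs ++ ys) i ≡ at xs i
at-++ˡ (x ∷ xs) {i = zero} _ = refl
at-++ˡ (x ∷ xs) {i = suc i} (s≤s i<) = at-++ˡ xs i<

at-++ʳ : ∀ xs {ys i} → at (xs ++ ys) (length xs + i) ≡ at ys i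
at-++ʳ [] = refl
at-++ʳ (x ∷ xs) = at-++ʳ xs

at-injective : ∀ {xs} → Unique xs → ∀ {i j} → i < length xs → j < length xs → at xs i ≡ at xs j → i ≡ j
at-injective _ {zero} {zero} _ _ _ = refl
at-injective {x ∷ xs} (x∉ ∷ _) {zero} {suc j} _ (s≤s j<) eq = contradiction eq (All.lookup x∉ (at-∈ xs j<))
at-injective {x ∷ xs} (x∉ ∷ _) {suc i} {zero} (s≤s i<) _ eq = contradiction (sym eq) (All.lookup x∉ (at-∈ xs i<))
at-injective {x ∷ xs} (_ ∷ u) {suc i} {suc j} (s≤s i<) (s≤s j<) eq = cong suc (at-injective u i< j< eq)

-- In a template the w new vertices, the l leaves, the q other vertices and the
-- l centres are numbered in this order.  Centres may coincide with each other
-- and with other vertices, so only paths that cannot collapse are allowed.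
Template : Set
Template = List (List ℕ)

steps : List ℕ → List Edge
steps (i ∷ j ∷ is) = (i , j) ∷ steps (j ∷ is)
steps _ = []

-- Meant for i preceding j on a path, hence not symmetric: only the first vertex may be a centre,
-- and then the other three are new vertices or leaves, which never equal a centre.
Apart : (w l q i j : ℕ) → Set
Apart w l q i j = j < w + l + q × i ≢ j × (i < w + l + q ⊎ (i < w + l + q + l × j < w + l))

apart? : ∀ w l q i j → Dec (Apart w l q i j)
apart? w l q i j = (j <? _) ×-dec ¬? (i ≟ j) ×-dec ((i <? _) ⊎-dec ((i <? _) ×-dec (j <? _)))

numbered : Bool → (w l q : ℕ) → List Edge
numbered b w l q = extension b (upTo w) (applyUpTo (λ i → w + i , w + l + q + i) l) (applyUpTo (w + l +_) q)

Valid₄ : (w l q : ℕ) → List ℕ → Set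
Valid₄ w l q is = length is ≡ 4 × AllPairs (Apart w l q) is

-- Decidable conditions on numerals. By pigeonhole they say that the paths partition the edges, so
-- evaluating `decomposes?` verifies a template.
record Decomposes (b : Bool) (w l q : ℕ) (ts : Template) : Set where
  constructor decomposes
  field
    valid  : All (Valid₄ w l q) ts
    once   : Unique (arcs (concatMap steps ts))
    inside : All (_∈ arcs (numbered b w l q)) (arcs (concatMap steps ts))
    count  : length (arcs (numbered b w l q)) ≤ length (arcs (concatMap steps ts))

decomposes? : ∀ b w l q ts → Dec (Decomposes b w l q ts)
decomposes? b w l q ts = map′ (λ (v , o , i , c) → decomposes v o i c) (λ (decomposes v o i c) → v , o , i , c)
  (All.all? (λ is → (length is ≟ 4) ×-dec allPairs? (apart? w l q) is) ts
   ×-dec uniqueEdges? _ ×-dec All.all? (_∈ₑ? _) _ ×-dec (_ ≤? _))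

module _ {W : List ℕ} {ls : List Edge} {qs : List ℕ} (good : Good W ls qs) where
  open Good good

  name : ℕ → ℕ
  name = at (base ++ map proj₂ ls)

  length-core : length core ≡ length W + length ls
  length-core = trans (length-++ W) (cong (length W +_) (length-map proj₁ ls))

  length-base : length base ≡ length W + length ls + length qs
  length-base = trans (length-++ core) (cong (_+ length qs) length-core)

  apart⇒≢ : ∀ {i j} → Apart (length W) (length ls) (length qs) i j → name i ≢ name j
  apart⇒≢ {i} {j} (j< , i≢j , inj₁ i<) eq = i≢j (at-injective base-unique (in-base i<) (in-base j<)
    (trans (sym (at-++ˡ base (in-base i<))) (trans eq (at-++ˡ base (in-base j<)))))
    where
    in-base : ∀ {k} → k < length W + length ls + length qs → k < length base
    in-base = subst (_ <_) (sym length-base)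
  apart⇒≢ {i} {j} (j< , i≢j , inj₂ (i< , j<core)) eq with i <? length base
  ... | yes i<′ = apart⇒≢ (j< , i≢j , inj₁ (subst (i <_) length-base i<′)) eq
  ... | no i≮ = All.lookup centres i∈ (subst (_∈ core) (sym eq) j∈)
    where
    j<′ : j < length core
    j<′ = subst (j <_) (sym length-core) j<core
    j∈ : name j ∈ core
    j∈ = subst (_∈ core) (sym (trans (cong (λ xs → at xs j) (++-assoc core qs (map proj₂ ls))) (at-++ˡ core j<′)))
        (at-∈ core j<′)
    i≡ : length base + (i ∸ length base) ≡ i
    i≡ = m+[n∸m]≡n (≮⇒≥ i≮)
    i∈ : name i ∈ map proj₂ ls
    i∈ = subst (_∈ map proj₂ ls) (trans (sym (at-++ʳ base)) (cong name i≡)) (at-∈ (map proj₂ ls)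
      (+-cancelˡ-< (length base) _ _ (subst₂ _<_ (sym i≡)
          (cong₂ _+_ (sym length-base) (sym (length-map proj₂ ls))) i<)))

  -- The partition is established on numerals and then renamed. `name` may identify vertices, which
  -- `≋-map` tolerates; distinctness is needed only within each path.
  template : ∀ {b} ts → Decomposes b (length W) (length ls) (length qs) ts →
    Decomposable (map (onEdges name) (numbered b (length W) (length ls) (length qs)))
  template ts (decomposes valid once inside count) = Decomposable-≋
    (≋-map name (mk≋ (Unique-covered⇒↭ once (All.lookup inside) count))) (named ts valid)
    where
    named : ∀ ts → All (Valid₄ (length W) (length ls) (length qs)) ts → Decomposable
        (map (onEdges name) (concatMap steps ts))
    named [] _ = [] , ≋-refl
    named ((i ∷ j ∷ k ∷ l ∷ []) ∷ ts) ((refl , apart) ∷ valid) =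
      let ps , ps≋ = named ts valid in
      quad (name i) (name j) (name k) (name l) (AllPairs.map⁺ (AllPairs.map apart⇒≢ apart)) ∷ ps ,
      ≋-++ (≋-refl {_ ∷ _ ∷ _ ∷ []}) ps≋

  -- For lists of explicit length both sides of the equation compute to the same edges, so `refl`
  -- proves it.
  gadget : ∀ {b} ts → {True (decomposes? b (length W) (length ls) (length qs) ts)} →
    map (onEdges name) (numbered b (length W) (length ls) (length qs)) ≡ extension b W ls qs →
    Decomposable (extension b W ls qs)
  gadget ts {d} eq = subst Decomposable eq (template ts (toWitness d))

Extends : Bool → List ℕ → (l q : ℕ) → Set
Extends b W l q = ∀ ls qs → length ls ≡ l → length qs ≡ q → Good W ls qs → Decomposable (extension b W ls qs)

module PermutationSolver = CommutativeMonoidSolver (++-commutativeMonoid {A = ℕ})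

Good-split : ∀ {W} ls₁ {ls₂} qs₁ {qs₂} → Good W (ls₁ ++ ls₂) (qs₁ ++ qs₂) → Good W ls₁ qs₁ × Good W ls₂ qs₂
Good-split {W} ls₁ {ls₂} qs₁ {qs₂} good = part W ls₁ ls₂ qs₁ qs₂ base-unique centres ,
  part W ls₂ ls₁ qs₂ qs₁
    (Unique-resp-↭ (++-↭ (++⁺ˡ W (map-↭ proj₁ (++-comm ls₁ ls₂))) (++-comm qs₁ qs₂)) base-unique)
    (All.tabulate λ h∈ → All.lookup centres (∈-resp-↭ (map-↭ proj₂ (++-comm ls₂ ls₁)) h∈)
       ∘ ∈-resp-↭ (++⁺ˡ W (map-↭ proj₁ (++-comm ls₂ ls₁))))
  where
  open Good good
  part : ∀ W ls₁ ls₂ qs₁ qs₂ → Unique ((W ++ map proj₁ (ls₁ ++ ls₂)) ++ qs₁ ++ qs₂) →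
    All (_∉ (W ++ map proj₁ (ls₁ ++ ls₂))) (map proj₂ (ls₁ ++ ls₂)) → Good W ls₁ qs₁
  part W ls₁ ls₂ qs₁ qs₂ u c = record
    { base-unique = proj₁ (Unique-++⁻ ((W ++ map proj₁ ls₁) ++ qs₁) (Unique-resp-↭
        (subst (λ ps → (W ++ ps) ++ qs₁ ++ qs₂ ↭ ((W ++ map proj₁ ls₁) ++ qs₁) ++ map proj₁ ls₂ ++ qs₂)
          (sym (map-++ proj₁ ls₁ ls₂))
          (PermutationSolver.solve 5 (λ w a b c d → ((w P.⊕ (a P.⊕ b)) P.⊕ (c P.⊕ d)) P.⊜
              (((w P.⊕ a) P.⊕ c) P.⊕ (b P.⊕ d)))
            ↭-refl W (map proj₁ ls₁) (map proj₁ ls₂) qs₁ qs₂)) u))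
    ; centres = All.map (λ h∉ → h∉ ∘ subst (_ ∈_) (cong (W ++_) (sym (map-++ proj₁ ls₁ ls₂))) ∘ widen)
        (All.++⁻ˡ (map proj₂ ls₁) (subst (All _) (map-++ proj₂ ls₁ ls₂) c)) }
    where
    module P = PermutationSolver
    widen : ∀ {x} → x ∈ W ++ map proj₁ ls₁ → x ∈ W ++ map proj₁ ls₁ ++ map proj₁ ls₂
    widen x∈ = [ ∈-++⁺ˡ , ∈-++⁺ʳ W ∘ ∈-++⁺ˡ ]′ (∈-++⁻ W x∈)

splitLength : (xs : List A) → ∀ m {n} → length xs ≡ m + n →
  ∃₂ λ ys zs → xs ≡ ys ++ zs × length ys ≡ m × length zs ≡ n
splitLength xs zero eq = [] , xs , refl , refl , eq
splitLength (x ∷ xs) (suc m) eq with splitLength xs m (suc-injective eq)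
... | ys , zs , refl , eqʸ , eqᶻ = x ∷ ys , zs , refl , cong suc eqʸ , eqᶻ

Extends-+ : ∀ {b W l q l′ q′} → Extends b W l q → Extends false W l′ q′ → Extends b W (l + l′) (q + q′)
Extends-+ {b} {W} {l} {q} f g ls qs eqˡ eqᵠ good with splitLength ls l eqˡ | splitLength qs q eqᵠ
... | ls₁ , ls₂ , refl , l₁ , l₂ | qs₁ , qs₂ , refl , q₁ , q₂ =
  let good₁ , good₂ = Good-split ls₁ qs₁ good in
  Decomposable-≋ (≋-trans
    (≡⇒≋ (cong (clique b W ++_) (cong₂ _++_ (concatMap-++ (claw W) ls₁ ls₂)
        (concatMap-++ (λ x → map (_, x) W) qs₁ qs₂))))
    (solve 5 (λ k x y z w → (k ⊕ ((x ⊕ y) ⊕ (z ⊕ w))) ⊜ ((k ⊕ (x ⊕ z)) ⊕ (y ⊕ w))) ≋-refl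
      (clique b W) (concatMap (claw W) ls₁) (concatMap (claw W) ls₂) (join W qs₁) (join W qs₂)))
    (Decomposable-++ (f ls₁ qs₁ l₁ q₁ good₁) (g ls₂ qs₂ l₂ q₂ good₂))

Extends-* : ∀ {W l q} → Extends false W l q → ∀ k → Extends false W (k * l) (k * q)
Extends-* f zero [] [] _ _ _ = [] , ≋-refl
Extends-* f (suc k) = Extends-+ {false} f (Extends-* f k)

-- The scheme for every residue class: one starting gadget that uses up the edges inside W, then
-- copies of a gadget for leaves alone and of one for other vertices alone.
Extends-multiples : ∀ {W l q l′ q′} → Extends true W l q → Extends false W l′ 0 → Extends false W 0 q′ →
  ∀ j k → Extends true W (l + j * l′) (q + k * q′)
Extends-multiples {W} {l} {q} {l′} {q′} f g h j k =
  subst₂ (Extends true W) (cong (l +_) (trans (cong (j * l′ +_) (*-zeroʳ k)) (+-identityʳ _)))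
      (cong (λ z → q + (z + k * q′)) (*-zeroʳ j))
    (Extends-+ {true} f (Extends-+ {false} (Extends-* g j) (Extends-* h k)))

-- The decompositions below were found by search.  Their names give the numbers of new vertices, of
-- leaves and of other vertices; ⁺ means that the edges between new vertices are included.

module _ {x y : ℕ} where
  private
    W : List ℕ
    W = x ∷ y ∷ []

  gadget2-2-0 : Extends false W 2 0
  gadget2-2-0 (_ ∷ _ ∷ []) [] refl refl good = gadget good {false}
    ((4 ∷ 2 ∷ 1 ∷ 3 ∷ []) ∷ (5 ∷ 3 ∷ 0 ∷ 2 ∷ []) ∷ []) refl

  gadget2-0-3 : Extends false W 0 3
  gadget2-0-3 [] (_ ∷ _ ∷ _ ∷ []) refl refl good = gadget good {false}
    ((0 ∷ 4 ∷ 1 ∷ 2 ∷ []) ∷ (1 ∷ 3 ∷ 0 ∷ 2 ∷ []) ∷ []) refl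

  gadget2-1-1⁺ : Extends true W 1 1
  gadget2-1-1⁺ (_ ∷ []) (_ ∷ []) refl refl good = gadget good {true}
    ((1 ∷ 3 ∷ 0 ∷ 2 ∷ []) ∷ (4 ∷ 2 ∷ 1 ∷ 0 ∷ []) ∷ []) refl

  gadget2-2-1⁺ : Extends true W 2 1
  gadget2-2-1⁺ (_ ∷ _ ∷ []) (_ ∷ []) refl refl good = gadget good {true}
    ((1 ∷ 4 ∷ 0 ∷ 3 ∷ []) ∷ (5 ∷ 2 ∷ 0 ∷ 1 ∷ []) ∷ (6 ∷ 3 ∷ 1 ∷ 2 ∷ []) ∷ []) refl

  gadget2-0-4⁺ : Extends true W 0 4
  gadget2-0-4⁺ [] (_ ∷ _ ∷ _ ∷ _ ∷ []) refl refl good = gadget good {true}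
    ((0 ∷ 3 ∷ 1 ∷ 4 ∷ []) ∷ (1 ∷ 2 ∷ 0 ∷ 5 ∷ []) ∷ (4 ∷ 0 ∷ 1 ∷ 5 ∷ []) ∷ []) refl

module _ {x y z : ℕ} where
  private
    W : List ℕ
    W = x ∷ y ∷ z ∷ []

  gadget3-6-0 : Extends false W 6 0
  gadget3-6-0 (_ ∷ _ ∷ _ ∷ _ ∷ _ ∷ _ ∷ []) [] refl refl good = gadget good {false}
    ((0 ∷ 5 ∷ 2 ∷ 4 ∷ []) ∷ (0 ∷ 6 ∷ 1 ∷ 3 ∷ []) ∷ (9 ∷ 3 ∷ 2 ∷ 7 ∷ []) ∷ (10 ∷ 4 ∷ 1 ∷ 8 ∷ []) ∷
     (11 ∷ 5 ∷ 1 ∷ 7 ∷ []) ∷ (12 ∷ 6 ∷ 2 ∷ 8 ∷ []) ∷ (13 ∷ 7 ∷ 0 ∷ 3 ∷ []) ∷ (14 ∷ 8 ∷ 0 ∷ 4 ∷ []) ∷ []) refl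

  gadget3-0-2 : Extends false W 0 2
  gadget3-0-2 [] (_ ∷ _ ∷ []) refl refl good = gadget good {false}
    ((2 ∷ 3 ∷ 1 ∷ 4 ∷ []) ∷ (2 ∷ 4 ∷ 0 ∷ 3 ∷ []) ∷ []) refl

  gadget3-0-1⁺ : Extends true W 0 1
  gadget3-0-1⁺ [] (_ ∷ []) refl refl good = gadget good {true}
    ((0 ∷ 2 ∷ 3 ∷ 1 ∷ []) ∷ (2 ∷ 1 ∷ 0 ∷ 3 ∷ []) ∷ []) refl

  gadget3-0-2⁺ : Extends true W 0 2
  gadget3-0-2⁺ [] (_ ∷ _ ∷ []) refl refl good = gadget good {true}
    ((1 ∷ 0 ∷ 2 ∷ 3 ∷ []) ∷ (1 ∷ 4 ∷ 0 ∷ 3 ∷ []) ∷ (3 ∷ 1 ∷ 2 ∷ 4 ∷ []) ∷ []) refl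

  gadget3-6-0⁺ : Extends true W 6 0
  gadget3-6-0⁺ (_ ∷ _ ∷ _ ∷ _ ∷ _ ∷ _ ∷ []) [] refl refl good = gadget good {true}
    ((0 ∷ 5 ∷ 1 ∷ 8 ∷ []) ∷ (2 ∷ 1 ∷ 0 ∷ 6 ∷ []) ∷ (2 ∷ 3 ∷ 1 ∷ 4 ∷ []) ∷ (9 ∷ 3 ∷ 0 ∷ 4 ∷ []) ∷
     (10 ∷ 4 ∷ 2 ∷ 8 ∷ []) ∷ (11 ∷ 5 ∷ 2 ∷ 6 ∷ []) ∷ (12 ∷ 6 ∷ 1 ∷ 7 ∷ []) ∷ (13 ∷ 7 ∷ 2 ∷ 0 ∷ []) ∷
     (14 ∷ 8 ∷ 0 ∷ 7 ∷ []) ∷ []) refl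

  gadget3-3-0⁺ : Extends true W 3 0
  gadget3-3-0⁺ (_ ∷ _ ∷ _ ∷ []) [] refl refl good = gadget good {true}
    ((1 ∷ 2 ∷ 0 ∷ 3 ∷ []) ∷ (2 ∷ 5 ∷ 0 ∷ 4 ∷ []) ∷ (6 ∷ 3 ∷ 1 ∷ 0 ∷ []) ∷ (7 ∷ 4 ∷ 2 ∷ 3 ∷ []) ∷
     (8 ∷ 5 ∷ 1 ∷ 4 ∷ []) ∷ []) refl

  gadget3-3-1⁺ : Extends true W 3 1
  gadget3-3-1⁺ (_ ∷ _ ∷ _ ∷ []) (_ ∷ []) refl refl good = gadget good {true}
    ((0 ∷ 6 ∷ 2 ∷ 5 ∷ []) ∷ (1 ∷ 4 ∷ 0 ∷ 2 ∷ []) ∷ (2 ∷ 3 ∷ 1 ∷ 6 ∷ []) ∷ (7 ∷ 3 ∷ 0 ∷ 5 ∷ []) ∷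
     (8 ∷ 4 ∷ 2 ∷ 1 ∷ []) ∷ (9 ∷ 5 ∷ 1 ∷ 0 ∷ []) ∷ []) refl

module _ {x y z t : ℕ} where
  private
    W : List ℕ
    W = x ∷ y ∷ z ∷ t ∷ []

  gadget4-6-0 : Extends false W 6 0
  gadget4-6-0 (_ ∷ _ ∷ _ ∷ _ ∷ _ ∷ _ ∷ []) [] refl refl good = gadget good {false}
    ((0 ∷ 6 ∷ 2 ∷ 4 ∷ []) ∷ (0 ∷ 7 ∷ 3 ∷ 4 ∷ []) ∷ (1 ∷ 8 ∷ 0 ∷ 4 ∷ []) ∷ (1 ∷ 9 ∷ 0 ∷ 5 ∷ []) ∷
     (10 ∷ 4 ∷ 1 ∷ 5 ∷ []) ∷ (11 ∷ 5 ∷ 2 ∷ 7 ∷ []) ∷ (12 ∷ 6 ∷ 3 ∷ 5 ∷ []) ∷ (13 ∷ 7 ∷ 1 ∷ 6 ∷ []) ∷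
     (14 ∷ 8 ∷ 3 ∷ 9 ∷ []) ∷ (15 ∷ 9 ∷ 2 ∷ 8 ∷ []) ∷ []) refl

  gadget4-0-3 : Extends false W 0 3
  gadget4-0-3 [] (_ ∷ _ ∷ _ ∷ []) refl refl good = gadget good {false}
    ((0 ∷ 5 ∷ 1 ∷ 4 ∷ []) ∷ (1 ∷ 6 ∷ 3 ∷ 5 ∷ []) ∷ (2 ∷ 6 ∷ 0 ∷ 4 ∷ []) ∷ (3 ∷ 4 ∷ 2 ∷ 5 ∷ []) ∷ []) refl

  gadget4-0-0⁺ : Extends true W 0 0
  gadget4-0-0⁺ [] [] refl refl good = gadget good {true}
    ((0 ∷ 2 ∷ 3 ∷ 1 ∷ []) ∷ (2 ∷ 1 ∷ 0 ∷ 3 ∷ []) ∷ []) refl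

  gadget4-1-1⁺ : Extends true W 1 1
  gadget4-1-1⁺ (_ ∷ []) (_ ∷ []) refl refl good = gadget good {true}
    ((1 ∷ 5 ∷ 0 ∷ 2 ∷ []) ∷ (2 ∷ 1 ∷ 3 ∷ 5 ∷ []) ∷ (2 ∷ 4 ∷ 0 ∷ 3 ∷ []) ∷ (4 ∷ 3 ∷ 2 ∷ 5 ∷ []) ∷
     (6 ∷ 4 ∷ 1 ∷ 0 ∷ []) ∷ []) refl

  gadget4-3-0⁺ : Extends true W 3 0
  gadget4-3-0⁺ (_ ∷ _ ∷ _ ∷ []) [] refl refl good = gadget good {true}
    ((0 ∷ 1 ∷ 3 ∷ 6 ∷ []) ∷ (3 ∷ 5 ∷ 0 ∷ 4 ∷ []) ∷ (4 ∷ 2 ∷ 1 ∷ 6 ∷ []) ∷ (5 ∷ 2 ∷ 0 ∷ 6 ∷ []) ∷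
     (7 ∷ 4 ∷ 3 ∷ 0 ∷ []) ∷ (8 ∷ 5 ∷ 1 ∷ 4 ∷ []) ∷ (9 ∷ 6 ∷ 2 ∷ 3 ∷ []) ∷ []) refl

  gadget4-4-1⁺ : Extends true W 4 1
  gadget4-4-1⁺ (_ ∷ _ ∷ _ ∷ _ ∷ []) (_ ∷ []) refl refl good = gadget good {true}
    ((0 ∷ 6 ∷ 2 ∷ 5 ∷ []) ∷ (0 ∷ 7 ∷ 3 ∷ 4 ∷ []) ∷ (0 ∷ 8 ∷ 1 ∷ 5 ∷ []) ∷ (2 ∷ 3 ∷ 1 ∷ 6 ∷ []) ∷
     (3 ∷ 0 ∷ 2 ∷ 7 ∷ []) ∷ (3 ∷ 8 ∷ 2 ∷ 4 ∷ []) ∷ (9 ∷ 4 ∷ 1 ∷ 0 ∷ []) ∷ (10 ∷ 5 ∷ 0 ∷ 4 ∷ []) ∷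
     (11 ∷ 6 ∷ 3 ∷ 5 ∷ []) ∷ (12 ∷ 7 ∷ 1 ∷ 2 ∷ []) ∷ []) refl

-- Two, three or four new vertices, by residue class

halve : ∀ n → ∃ λ k → n ≡ k * 2 ⊎ n ≡ 1 + k * 2
halve n with n % 2 | m%n<n n 2 | m≡m%n+[m/n]*n n 2
... | 0 | _ | eq = n / 2 , inj₁ eq
... | 1 | _ | eq = n / 2 , inj₂ eq
... | suc (suc _) | s≤s (s≤s ()) | _

-- There are 1 + 3 l + 2 q edges, whence q ≡ 1 mod 3. Leaves go in pairs, because a single leaf with
-- its centre and two new vertices is a claw.
extends₂ : ∀ {x y} l j → 4 ≤ l + (1 + j * 3) → Extends true (x ∷ y ∷ []) l (1 + j * 3)
extends₂ l j 4≤ with halve l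
extends₂ l j 4≤ | k , inj₂ refl = Extends-multiples gadget2-1-1⁺ gadget2-2-0 gadget2-0-3 k j
extends₂ l j 4≤ | suc k , inj₁ refl = Extends-multiples gadget2-2-1⁺ gadget2-2-0 gadget2-0-3 k j
extends₂ l (suc j) 4≤ | zero , inj₁ refl = Extends-multiples gadget2-0-4⁺ gadget2-2-0 gadget2-0-3 0 j
-- Here only a triangle on the two new vertices and one other would remain: three edges, but no P₄.
extends₂ l zero (s≤s ()) | zero , inj₁ refl

double-triple : ∀ k → k * 2 * 3 ≡ k * 6
double-triple k = *-assoc k 2 3

-- There are 3 + 4 l + 3 q edges, so l is a multiple of 3 and q is free. The repeated gadget has six
-- leaves: with three, each new vertex would have odd degree and so end some path, but three of the
-- four paths would run from a centre to a leaf, leaving one such end.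
extends₃ : ∀ {x y z} t q → 1 ≤ t * 3 + q → Extends true (x ∷ y ∷ z ∷ []) (t * 3) q
extends₃ t q 1≤ with halve t | halve q
... | k , inj₁ refl | m , inj₂ refl rewrite double-triple k =
    Extends-multiples gadget3-0-1⁺ gadget3-6-0 gadget3-0-2 k m
... | suc k , inj₁ refl | m , inj₁ refl rewrite double-triple k =
    Extends-multiples gadget3-6-0⁺ gadget3-6-0 gadget3-0-2 k m
... | zero , inj₁ refl | suc m , inj₁ refl = Extends-multiples gadget3-0-2⁺ gadget3-6-0 gadget3-0-2 0 m
... | k , inj₂ refl | m , inj₁ refl rewrite double-triple k =
    Extends-multiples gadget3-3-0⁺ gadget3-6-0 gadget3-0-2 k m
... | k , inj₂ refl | m , inj₂ refl rewrite double-triple k =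
    Extends-multiples gadget3-3-1⁺ gadget3-6-0 gadget3-0-2 k m
-- With no leaf and no other vertex, W itself would be a bare triangle.
extends₃ t q () | zero , inj₁ refl | zero , inj₁ refl

-- There are 6 + 5 l + 4 q edges, whence l ≡ q mod 3. By `leaf-residues` only the classes 0, here,
-- and 1, in `extends₄′`, occur.
extends₄ : ∀ {x y z u} t j → Extends true (x ∷ y ∷ z ∷ u ∷ []) (t * 3) (j * 3)
extends₄ t j with halve t
... | k , inj₁ refl rewrite double-triple k = Extends-multiples gadget4-0-0⁺ gadget4-6-0 gadget4-0-3 k j
... | k , inj₂ refl rewrite double-triple k = Extends-multiples gadget4-3-0⁺ gadget4-6-0 gadget4-0-3 k j

extends₄′ : ∀ {x y z u} t j → Extends true (x ∷ y ∷ z ∷ u ∷ []) (1 + t * 3) (1 + j * 3)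
extends₄′ t j with halve t
... | k , inj₁ refl rewrite double-triple k = Extends-multiples gadget4-1-1⁺ gadget4-6-0 gadget4-0-3 k j
... | k , inj₂ refl rewrite double-triple k = Extends-multiples gadget4-4-1⁺ gadget4-6-0 gadget4-0-3 k j

-- The number l of edges left over from T(v) = 4 (3 m + l) satisfies l ≡ T(v) mod 3, where v = l + q.
leaf-residues : ∀ a b → a < 3 → b < 3 → a ≡ triangle ((a + b) % 3) % 3 →
  (a ≡ 0 × b ≡ 0) ⊎ (a ≡ 0 × b ≡ 1) ⊎ (a ≡ 1 × b ≡ 1)
leaf-residues 0 0 _ _ _ = inj₁ (refl , refl)
leaf-residues 0 1 _ _ _ = inj₂ (inj₁ (refl , refl))
leaf-residues 0 2 _ _ ()
leaf-residues 1 0 _ _ ()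
leaf-residues 1 1 _ _ _ = inj₂ (inj₂ (refl , refl))
leaf-residues 1 2 _ _ ()
leaf-residues 2 0 _ _ ()
leaf-residues 2 1 _ _ ()
leaf-residues 2 2 _ _ ()
leaf-residues (suc (suc (suc _))) _ (s≤s (s≤s (s≤s ()))) _ _
leaf-residues _ (suc (suc (suc _))) _ (s≤s (s≤s (s≤s ()))) _

01Mod3 : ℕ → Set
01Mod3 n = n % 3 ≡ 0 ⊎ n % 3 ≡ 1

two≢ : ¬ (2 ≡ 0 ⊎ 2 ≡ 1)
two≢ (inj₁ ())
two≢ (inj₂ ())

-- Three classes of (l, q) against e = 0, 1, 2: in each class exactly one e gives n ≡ 2 mod 3, and
-- the other two match `extends₂`, `extends₃`, `extends₄` or `extends₄′`.
extends-residues : ∀ a b t j e → e < 3 → 4 ≤ a + t * 3 + (b + j * 3) →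
  (a ≡ 0 × b ≡ 0) ⊎ (a ≡ 0 × b ≡ 1) ⊎ (a ≡ 1 × b ≡ 1) → 01Mod3 (a + b + (2 + e)) →
  ∀ W → length W ≡ 2 + e → Extends true W (a + t * 3) (b + j * 3)
extends-residues _ _ t j 0 _ 4≤ (inj₁ (refl , refl)) n%3 = contradiction n%3 two≢
extends-residues _ _ t j 1 _ 4≤ (inj₁ (refl , refl)) _ (_ ∷ _ ∷ _ ∷ []) refl = extends₃ t (j * 3)
    (≤-trans (s≤s z≤n) 4≤)
extends-residues _ _ t j 2 _ 4≤ (inj₁ (refl , refl)) _ (_ ∷ _ ∷ _ ∷ _ ∷ []) refl = extends₄ t j
extends-residues _ _ t j 0 _ 4≤ (inj₂ (inj₁ (refl , refl))) _ (_ ∷ _ ∷ []) refl = extends₂ (t * 3) j 4≤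
extends-residues _ _ t j 1 _ 4≤ (inj₂ (inj₁ (refl , refl))) _ (_ ∷ _ ∷ _ ∷ []) refl = extends₃ t (1 + j * 3)
    (≤-trans (s≤s z≤n) 4≤)
extends-residues _ _ t j 2 _ 4≤ (inj₂ (inj₁ (refl , refl))) n%3 = contradiction n%3 two≢
extends-residues _ _ t j 0 _ 4≤ (inj₂ (inj₂ (refl , refl))) _ (_ ∷ _ ∷ []) refl = extends₂ (1 + t * 3) j 4≤
extends-residues _ _ t j 1 _ 4≤ (inj₂ (inj₂ (refl , refl))) n%3 = contradiction n%3 two≢
extends-residues _ _ t j 2 _ 4≤ (inj₂ (inj₂ (refl , refl))) _ (_ ∷ _ ∷ _ ∷ _ ∷ []) refl = extends₄′ t j
extends-residues _ _ _ _ (suc (suc (suc _))) (s≤s (s≤s (s≤s ()))) _ _ _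

triangle-%3 : ∀ n → triangle n % 3 ≡ triangle (n % 3) % 3
triangle-%3 0 = refl
triangle-%3 1 = refl
triangle-%3 2 = refl
triangle-%3 (suc (suc (suc n))) = begin
  triangle (3 + n) % 3             ≡⟨ cong (_% 3)
      (trans (triangle-3+ n) (trans (+-comm (3 * suc n) _) (cong (triangle n +_) (*-comm 3 (suc n))))) ⟩
  (triangle n + suc n * 3) % 3     ≡⟨ [m+kn]%n≡m%n (triangle n) (suc n) 3 ⟩
  triangle n % 3                   ≡⟨ triangle-%3 n ⟩
  triangle (n % 3) % 3             ∎
  where open ≡-Reasoning

extends-order : ∀ {l q m e k} → 4 ≤ l + q → triangle (l + q) ≡ (m * 3 + l) * 4 → e < 3 →
  01Mod3 (l + q + (2 + e) + k * 3) → ∀ W → length W ≡ 2 + e → Extends true W l q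
extends-order {l} {q} {m} {e} {k} 4≤ count e<3 n%3 W len =
  subst₂ (Extends true W) (sym l≡) (sym q≡)
    (extends-residues (l % 3) (q % 3) (l / 3) (q / 3) e e<3
      (subst (4 ≤_) (cong₂ _+_ l≡ q≡) 4≤)
      (leaf-residues (l % 3) (q % 3) (m%n<n l 3) (m%n<n q 3) residue)
      (subst (λ r → r ≡ 0 ⊎ r ≡ 1) total n%3) W len)
  where
  open ≡-Reasoning
  l≡ : l ≡ l % 3 + l / 3 * 3
  l≡ = m≡m%n+[m/n]*n l 3
  q≡ : q ≡ q % 3 + q / 3 * 3
  q≡ = m≡m%n+[m/n]*n q 3
  regroup : ∀ l m → (m * 3 + l) * 4 ≡ l + (m * 4 + l) * 3
  regroup = solve-∀
  residue : l % 3 ≡ triangle ((l % 3 + q % 3) % 3) % 3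
  residue = begin
    l % 3                                  ≡⟨ [m+kn]%n≡m%n l (m * 4 + l) 3 ⟨
    (l + (m * 4 + l) * 3) % 3              ≡⟨ cong (_% 3) (trans count (regroup l m)) ⟨
    triangle (l + q) % 3                   ≡⟨ triangle-%3 (l + q) ⟩
    triangle ((l + q) % 3) % 3             ≡⟨ cong (λ r → triangle r % 3) (%-distribˡ-+ l q 3) ⟩
    triangle ((l % 3 + q % 3) % 3) % 3     ∎
  reorder : ∀ a t b j e k → a + t * 3 + (b + j * 3) + (2 + e) + k * 3 ≡ a + b + (2 + e) + (t + j + k) * 3
  reorder = solve-∀
  total : (l + q + (2 + e) + k * 3) % 3 ≡ (l % 3 + q % 3 + (2 + e)) % 3
  total = begin
    (l + q + (2 + e) + k * 3) % 3   ≡⟨ cong (λ x → (x + (2 + e) + k * 3) % 3) (cong₂ _+_ l≡ q≡) ⟩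
    (l % 3 + l / 3 * 3 + (q % 3 + q / 3 * 3) + (2 + e) + k * 3) % 3 ≡⟨ cong (_% 3)
        (reorder (l % 3) (l / 3) (q % 3) (q / 3) e k) ⟩
    (l % 3 + q % 3 + (2 + e) + (l / 3 + q / 3 + k) * 3) % 3 ≡⟨ [m+kn]%n≡m%n (l % 3 + q % 3 + (2 + e))
        (l / 3 + q / 3 + k) 3 ⟩
    (l % 3 + q % 3 + (2 + e)) % 3   ∎

-- Enlarging the point set

join-∷ : ∀ w W V → join (w ∷ W) V ↭ map (w ,_) V ++ join W V
join-∷ w W [] = ↭-refl
join-∷ w W (x ∷ V) = prep (w , x)
    (↭-trans (++⁺ˡ (map (_, x) W) (join-∷ w W V)) (shifts (map (_, x) W) (map (w ,_) V)))

join-[] : ∀ V → join [] V ≡ []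
join-[] [] = refl
join-[] (_ ∷ V) = join-[] V

join-[-] : ∀ w V → join [ w ] V ≡ map (w ,_) V
join-[-] w [] = refl
join-[-] w (x ∷ V) = cong ((w , x) ∷_) (join-[-] w V)

pairs-++ : ∀ W V → pairs (W ++ V) ≋ (pairs W ++ join W V) ++ pairs V
pairs-++ [] V = ↭⇒≋ (++⁺ʳ (pairs V) (↭-reflexive (sym (join-[] V))))
pairs-++ (w ∷ W) V = ≋-trans
  (≋-++ (≡⇒≋ (map-++ (w ,_) W V)) (pairs-++ W V))
  (≋-trans (solve 5 (λ a b c d e → ((a ⊕ b) ⊕ ((c ⊕ d) ⊕ e)) ⊜ (((a ⊕ c) ⊕ (b ⊕ d)) ⊕ e)) ≋-refl
      (map (w ,_) W) (map (w ,_) V) (pairs W) (join W V) (pairs V))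
    (≋-++ (≋-++ (≋-refl {map (w ,_) W ++ pairs W}) (≋-sym (↭⇒≋ (join-∷ w W V)))) ≋-refl))

forestJoin-≋ : ∀ W ls qs → forestJoin W ls qs ≋ ls ++ join W (map proj₁ ls ++ qs)
forestJoin-≋ W [] qs = ≋-refl
forestJoin-≋ W (l@(p , _) ∷ ls) qs = ≋-trans
  (≡⇒≋ (++-assoc (claw W l) (concatMap (claw W) ls) (join W qs)))
  (≋-trans (≋-++ (≋-refl {claw W l}) (forestJoin-≋ W ls qs))
    (solve 4 (λ a b c d → ((a ⊕ b) ⊕ (c ⊕ d)) ⊜ ((a ⊕ c) ⊕ (b ⊕ d))) ≋-refl
      [ l ] (map (_, p) W) ls (join W (map proj₁ ls ++ qs))))

∈⇒≤sum : ∀ {x xs} → x ∈ xs → x ≤ sum xs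
∈⇒≤sum {xs = x ∷ xs} (here refl) = m≤m+n x (sum xs)
∈⇒≤sum {xs = y ∷ xs} (there x∈) = ≤-trans (∈⇒≤sum x∈) (m≤n+m (sum xs) y)

fresh : ∀ w {xs : List ℕ} → Unique xs → ∃ λ (W : List ℕ) → length W ≡ w × Unique (W ++ xs)
fresh zero u = [] , refl , u
fresh (suc w) {xs} u with fresh w u
-- One more than the sum of all labels exceeds each of them.
... | W , len , u′ = suc (sum (W ++ xs)) ∷ W , cong suc len ,
  All.tabulate (λ x∈ → ≢-sym (<⇒≢ (s≤s (∈⇒≤sum x∈)))) ∷ u′

module _ {stars : List Quad} (forest : StarForest stars) {V : List ℕ}
  (corners⊆V : ∀ {r x} → r ∈ stars → x ∈ corners r → x ∈ V) where
  open StarForest forest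

  leaves⊆V : ∀ {x} → x ∈ map Quad.a stars → x ∈ V
  leaves⊆V x∈ with ∈-map⁻ Quad.a x∈
  ... | r , r∈ , refl = corners⊆V r∈ (here refl)

  others : List ℕ
  others = proj₁ (Unique⇒complement leaves-unique leaves⊆V)

  V-↭ : V ↭ map proj₁ (map cutEdge stars) ++ others
  V-↭ = subst (λ ps → V ↭ ps ++ others) (map-∘ stars) (proj₂ (Unique⇒complement leaves-unique leaves⊆V))

  forest-length : length V ≡ length stars + length others
  forest-length = trans (↭-length V-↭) (trans (length-++ (map proj₁ (map cutEdge stars)))
    (cong (_+ length others) (trans (length-map proj₁ (map cutEdge stars)) (length-map cutEdge stars))))

  forest-good : ∀ {W} → Unique (W ++ V) → Good W (map cutEdge stars) others
  forest-good {W} u = record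
    { base-unique = subst Unique (sym (++-assoc W _ others)) (Unique-resp-↭ (++⁺ˡ W V-↭) u)
    ; centres = All.tabulate λ h∈ h∈core → centre h∈ h∈core }
    where
    centre : ∀ {h} → h ∈ map proj₂ (map cutEdge stars) → h ∉ W ++ map proj₁ (map cutEdge stars)
    centre h∈ h∈core with ∈-map⁻ Quad.b (subst (_ ∈_) (sym (map-∘ stars)) h∈) | ∈-++⁻ W h∈core
    ... | r , r∈ , refl | inj₁ h∈W = proj₂ (proj₂ (Unique-++⁻ W u)) (h∈W , corners⊆V r∈ (there (here refl)))
    ... | r , r∈ , refl | inj₂ h∈leaves with ∈-map⁻ Quad.a (subst (_ ∈_) (sym (map-∘ stars)) h∈leaves)
    ...   | r′ , r′∈ , eq = leaves-private r′∈ r∈ (here (sym eq))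

  forest-extends : ∀ {W} → Unique (W ++ V) → Extends true W (length stars) (length others) →
    Decomposable (map cutEdge stars ++ pairs W ++ join W V)
  forest-extends {W} u extends = Decomposable-≋
    (≋-trans (≋-++ (≋-refl {map cutEdge stars})
        (≋-++ (≋-refl {pairs W}) (↭⇒≋ (concatMap-↭ (λ x → map (_, x) W) V-↭))))
      (≋-trans (solve 3 (λ a b c → (a ⊕ (b ⊕ c)) ⊜ (b ⊕ (a ⊕ c))) ≋-refl (map cutEdge stars) (pairs W) _)
        (≋-++ (≋-refl {pairs W}) (≋-sym (forestJoin-≋ W (map cutEdge stars) others)))))
    (extends (map cutEdge stars) others (length-map cutEdge stars) refl (forest-good u))

cut-split : ∀ {s} {q : Fin s → Quad} (cs : List (Cut q)) →
  concatMap (cycleEdges ∘ q ∘ index) cs ≋ concatMap pathEdges (map kept cs) ++ map edge cs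
cut-split [] = ≋-refl
cut-split (c@(cut i r same) ∷ cs) = ≋-trans (≋-++ (≋-sym same) (cut-split cs))
  (solve 4 (λ e p x y → ((e ⊕ p) ⊕ (x ⊕ y)) ⊜ ((p ⊕ x) ⊕ (e ⊕ y))) ≋-refl
    [ cutEdge r ] (pathEdges (rotate r)) (concatMap pathEdges (map kept cs)) (map edge cs))

pairs-split : ∀ {s V} {q : Fin s → Quad} (cs : List (Cut q)) → map index cs ↭ allFin s →
  pairs V ≋ concatMap (cycleEdges ∘ q) (allFin s) →
  pairs V ≋ concatMap pathEdges (map kept cs) ++ map edge cs
pairs-split {s} {V} {q} cs indices V≋ = ≋-trans V≋ (≋-trans
  (↭⇒≋ (↭-trans (concatMap-↭ (cycleEdges ∘ q) (↭-sym indices))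
    (↭-reflexive (concatMap-map (cycleEdges ∘ q) index cs)))) (cut-split cs))

CompletedBy-++ : ∀ {kept R W V} → pairs V ≋ concatMap pathEdges kept ++ R →
  Decomposable (R ++ pairs W ++ join W V) → CompletedBy kept (W ++ V)
CompletedBy-++ {kept} {R} {W} {V} V≋ (ps , R≋) = ps , ≋-trans (pairs-++ W V)
  (≋-trans (≋-++ (≋-refl {pairs W ++ join W V}) V≋)
    (≋-trans (solve 3 (λ a b c → (a ⊕ (b ⊕ c)) ⊜ (b ⊕ (c ⊕ a))) ≋-refl (pairs W ++ join W V)
        (concatMap pathEdges kept) R)
      (≋-trans (≋-++ (≋-refl {concatMap pathEdges kept}) R≋) (≡⇒≋ (sym (concatMap-++ pathEdges kept ps))))))

-- `extends₃` without leaves puts no condition on the number of other vertices, so all of U can play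
-- that role, and the paths on U stay as they are.
CompletedBy-3* : ∀ k {kept U} → Unique U → 1 ≤ length U → CompletedBy kept U →
  ∃ λ U′ → Unique U′ × length U′ ≡ length U + k * 3 × CompletedBy kept U′
CompletedBy-3* zero u _ c = _ , u , sym (+-identityʳ _) , c
CompletedBy-3* (suc k) {kept} {U} u 1≤ (ps , U≋) with fresh 3 u
... | W@(_ ∷ _ ∷ _ ∷ []) , refl , u′ =
  let qs , W≋ = extends₃ 0 (length U) 1≤ [] U refl refl (record
        { base-unique = u′ ; centres = [] })
      U′ , u″ , len , c = CompletedBy-3* k {kept} u′ (s≤s z≤n) (ps ++ qs , enlarge qs W≋)
  in U′ , u″ , trans len (shift-3 (length U) k) , c
  where
  shift-3 : ∀ m k → 3 + m + k * 3 ≡ m + suc k * 3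
  shift-3 = solve-∀
  enlarge : ∀ qs → pairs W ++ join W U ≋ concatMap pathEdges qs → pairs (W ++ U) ≋ concatMap pathEdges
      (kept ++ ps ++ qs)
  enlarge qs W≋ = ≋-trans (pairs-++ W U) (≋-trans (≋-++ W≋ U≋)
    (≋-trans (↭⇒≋ (++-comm (concatMap pathEdges qs) (concatMap pathEdges (kept ++ ps))))
      (≡⇒≋ (sym (trans (cong (concatMap pathEdges) (sym (++-assoc kept ps qs)))
          (concatMap-++ pathEdges (kept ++ ps) qs))))))

-- Down-links from every design to the orders from v + 2 on

%8≡1⇒≥9 : ∀ {v} → v > 1 → v % 8 ≡ 1 → 9 ≤ v
%8≡1⇒≥9 {v} v>1 v%8≡1 with v <? 9
... | no v≮9 = ≮⇒≥ v≮9
... | yes v<9 = small v v>1 v<9 v%8≡1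
  where
  small : ∀ v → v > 1 → v < 9 → v % 8 ≡ 1 → 9 ≤ v
  small 1 (s≤s ()) _ _
  small 2 _ _ ()
  small 3 _ _ ()
  small 4 _ _ ()
  small 5 _ _ ()
  small 6 _ _ ()
  small 7 _ _ ()
  small 8 _ _ ()
  small (suc (suc (suc (suc (suc (suc (suc (suc (suc _))))))))) _
      (s≤s (s≤s (s≤s (s≤s (s≤s (s≤s (s≤s (s≤s (s≤s ()))))))))) _

C₄-order≥9 : ∀ {v} → v > 1 → DesignOfOrder C₄ v → 9 ≤ v
C₄-order≥9 v>1 𝓑 = %8≡1⇒≥9 v>1 (C₄-order (<-trans z<s v>1) 𝓑)

downLink-cutting : ∀ {v n} → v > 1 → (𝓑 : DesignOfOrder C₄ v) → v + 2 ≤ n → 01Mod3 n →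
  (let open DesignOfOrder 𝓑 using (points) ; open Cycle.ToList (design 𝓑)) →
  Cutting.Cutting blockQuad shared-arc (allFin (Design.size (design 𝓑))) →
  ∀ W → length W ≡ 2 + (n ∸ (v + 2)) % 3 → Unique (W ++ points) →
  Σ[ 𝓑′ ∈ DesignOfOrder P₄ n ] DownLink (design 𝓑) (design 𝓑′)
downLink-cutting {v} {n} v>1 𝓑 v+2≤n n%3 cutting W W-length W-unique = assemble 𝓑 cuts
    (λ i → ∈-resp-↭ (↭-sym indices) (∈-allFin i))
    U U-unique (trans U-length (trans (cong (_+ k * 3) W++V-length) n≡))
        (≤-trans v>1 (≤-trans (m≤m+n v 2) v+2≤n)) completed
  where
  open DesignOfOrder 𝓑 hiding (design)
  open Design (design 𝓑) using (size; block; block⊑K)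
  open Cycle.ToList (design 𝓑)
  open Cutting.Cutting cutting

  -- n = v + (2 + e) + 3 k: the first 2 + e new vertices absorb the star forest, the rest come in
  -- threes. Of the cut edges, 3 m lie in paths and l in stars.
  e k l m : ℕ
  e = (n ∸ (v + 2)) % 3
  k = (n ∸ (v + 2)) / 3
  l = length stars
  m = length paths

  corners⊆points : ∀ {r x} → r ∈ stars → x ∈ corners r → x ∈ points
  corners⊆points {r} r∈ x∈ = let i , r≋ = origin r∈ in
    proj₁ (block⊑K i) (Cycle.Presents.vert⇐ (presents i) (cycle-corners {r} {blockQuad i} r≋ x∈))

  q : ℕ
  q = length (others forest corners⊆points)

  V≡ : length points ≡ l + q
  V≡ = forest-length forest corners⊆points

  v≡ : v ≡ l + q
  v≡ = trans (sym order) V≡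

  size≡ : length (allFin size) ≡ m * 3 + l
  size≡ = begin
    length (allFin size)                                              ≡⟨ ↭-length indices ⟨
    length (map index cuts)                                           ≡⟨ length-map index cuts ⟩
    length cuts                                                       ≡⟨ length-map edge cuts ⟨
    length (map edge cuts)                                            ≡⟨ ≋-length split ⟩
    length (concatMap pathEdges paths ++ map cutEdge stars)           ≡⟨ length-++ (concatMap pathEdges paths) ⟩
    length (concatMap pathEdges paths) + length (map cutEdge stars)   ≡⟨ cong₂ _+_
        (length-concatMap pathEdges 3 (λ _ → refl) paths) (length-map cutEdge stars) ⟩
    m * 3 + l                                                         ∎
    where open ≡-Reasoning

  count : triangle (l + q) ≡ (m * 3 + l) * 4
  count = begin
    triangle (l + q)                                          ≡⟨ cong triangle V≡ ⟨
    triangle (length points)                                  ≡⟨ length-pairs points ⟨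
    length (pairs points)                                     ≡⟨ ≋-length toList ⟩
    length (concatMap (cycleEdges ∘ blockQuad) (allFin size)) ≡⟨ length-concatMap _ 4 (λ _ → refl) (allFin size) ⟩
    length (allFin size) * 4                                  ≡⟨ cong (_* 4) size≡ ⟩
    (m * 3 + l) * 4                                           ∎
    where open ≡-Reasoning

  n≡ : v + (2 + e) + k * 3 ≡ n
  n≡ = trans (reorder v e k) (trans (cong (v + 2 +_) (sym (m≡m%n+[m/n]*n (n ∸ (v + 2)) 3))) (m+[n∸m]≡n v+2≤n))
    where
    reorder : ∀ v e k → v + (2 + e) + k * 3 ≡ v + 2 + (e + k * 3)
    reorder = solve-∀

  W++V-length : length (W ++ points) ≡ v + (2 + e)
  W++V-length = trans (length-++ W) (trans (+-comm (length W) _) (cong₂ _+_ order W-length))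

  extendable : Extends true W l q
  extendable = extends-order {l} {q} {m} {e} {k}
    (subst (4 ≤_) v≡ (≤-trans (s≤s (s≤s (s≤s (s≤s z≤n)))) (C₄-order≥9 v>1 𝓑)))
    count (m%n<n (n ∸ (v + 2)) 3)
    (subst (λ x → 01Mod3 (x + (2 + e) + k * 3)) v≡ (subst 01Mod3 (sym n≡) n%3)) W W-length

  completedBase : CompletedBy (map kept cuts) (W ++ points)
  completedBase = CompletedBy-++ {map kept cuts} {map edge cuts} {W} {points}
      (pairs-split {V = points} cuts indices toList)
    (Decomposable-≋ (≋-trans (≋-++ split (≋-refl {pairs W ++ join W points}))
        (≡⇒≋ (++-assoc (concatMap pathEdges paths) (map cutEdge stars) _)))
      (Decomposable-++ (paths , ≋-refl) (forest-extends forest corners⊆points W-unique extendable)))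

  enlarged : ∃ λ U → Unique U × length U ≡ length (W ++ points) + k * 3 × CompletedBy (map kept cuts) U
  enlarged = CompletedBy-3* k {map kept cuts} W-unique
    (subst (1 ≤_) (sym W++V-length) (≤-trans (s≤s z≤n) (m≤n+m (2 + e) v))) completedBase

  U : List ℕ
  U = proj₁ enlarged

  U-unique : Unique U
  U-unique = proj₁ (proj₂ enlarged)

  U-length : length U ≡ length (W ++ points) + k * 3
  U-length = proj₁ (proj₂ (proj₂ enlarged))

  completed : CompletedBy (map kept cuts) U
  completed = proj₂ (proj₂ (proj₂ enlarged))

downLink-v+2≤ : ∀ {v n} → v > 1 → (𝓑 : DesignOfOrder C₄ v) → v + 2 ≤ n → 01Mod3 n →
  Σ[ 𝓑′ ∈ DesignOfOrder P₄ n ] DownLink (design 𝓑) (design 𝓑′)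
downLink-v+2≤ {v} {n} v>1 𝓑 v+2≤n n%3 =
  let W , W-length , W-unique = fresh (2 + (n ∸ (v + 2)) % 3) (DesignOfOrder.points-unique 𝓑) in
  downLink-cutting v>1 𝓑 v+2≤n n%3
    (cutting (length (allFin size)) (allFin size) ≤-refl (Unique.allFin⁺ size)) W W-length W-unique
  where
  open Design (design 𝓑) using (size)
  open Cycle.ToList (design 𝓑)
  open Cutting blockQuad shared-arc

-- Cyclic designs

map-index-cuts : ∀ {s} {q : Fin s → Quad} (r : Fin s → Quad) (same : ∀ i → cycleEdges (r i) ≋ cycleEdges (q i)) →
  map (index {q = q}) (map (λ i → cut i (r i) (same i)) (allFin s)) ↭ allFin s
map-index-cuts r same = ↭-reflexive (trans (sym (map-∘ (allFin _))) (map-id (allFin _)))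

-- The first edge of every listed cycle is cut.
listed-design : ∀ {V W : List ℕ} → Unique V → length V > 1 → (qs : List Quad) → pairs V ≋ concatMap cycleEdges qs →
  Unique (W ++ V) → Decomposable (map cutEdge qs ++ pairs W ++ join W V) → ℒ₁ C₄ (length V) (length (W ++ V))
listed-design {x ∷ []} _ (s≤s ()) _ _ _ _
listed-design {V@(x ∷ y ∷ _)} {W} u@((x≢y ∷ _) ∷ _) V>1 qs V≋ u′ rest =
  𝓑 , assemble 𝓑 cuts (λ i → ∈-resp-↭ (↭-sym (map-index-cuts (lookup qs) same)) (∈-allFin i)) (W ++ V) u′ refl
    (≤-trans V>1 (subst (length V ≤_) (sym (length-++ W)) (m≤n+m (length V) (length W))))
    (CompletedBy-++ {map kept cuts} {map edge cuts} {W} {V}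
      (pairs-split {V = V} cuts (map-index-cuts (lookup qs) same) toList)
      (subst (λ E → Decomposable (E ++ pairs W ++ join W V)) (sym cut≡) rest))
  where
  module L = Cycle.FromList u qs V≋
  i₀ : Fin (length qs)
  i₀ = proj₁ (L.arc-block (∈-arcs-pairs⁺ {V} (here refl) (there (here refl)) x≢y))
  𝓑 : DesignOfOrder C₄ (length V)
  𝓑 = record { points = V ; points-unique = u ; order = refl ; design = Cycle.fromList u qs V≋ i₀ }
  open Cycle.ToList (design 𝓑)
  same : ∀ i → cycleEdges (lookup qs i) ≋ cycleEdges (blockQuad i)
  same i = mk≋ (Unique⇒↭ (Cycle.Unique-arcs-edgesOf (lookup qs i)) (Cycle.Unique-arcs-edgesOf (blockQuad i))
    (Cycle.Presents.adj⇒ (presents i)) (Cycle.Presents.adj⇐ (presents i)))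
  cuts : List (Cut blockQuad)
  cuts = map (λ i → cut i (lookup qs i) (same i)) (allFin (length qs))
  cut≡ : map edge cuts ≡ map cutEdge qs
  cut≡ = begin
    map edge cuts                                     ≡⟨ map-∘ (allFin (length qs)) ⟨
    map (cutEdge ∘ lookup qs) (allFin (length qs))    ≡⟨ map-∘ (allFin (length qs)) ⟩
    map cutEdge (map (lookup qs) (allFin (length qs))) ≡⟨ cong (map cutEdge)
        (trans (map-tabulate id (lookup qs)) (tabulate-lookup qs)) ⟩
    map cutEdge qs                                    ∎
    where open ≡-Reasoning

-- Regroups the edges of a family of paths from path by path to position by position, that is, orbit
-- by orbit.
concatMap-triple : {f g h : A → B} (xs : List A) → concatMap (λ x → f x ∷ g x ∷ h x ∷ []) xs ↭ map f xs ++
    map g xs ++ map h xs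
concatMap-triple [] = ↭-refl
concatMap-triple {f = f} {g} {h} (x ∷ xs) = prep (f x) (↭-trans
  (prep (g x) (↭-trans (prep (h x) (concatMap-triple xs))
    (↭-trans (↭-sym (shift (h x) (map f xs) (map g xs ++ map h xs)))
      (++⁺ˡ (map f xs) (↭-sym (shift (h x) (map g xs) (map h xs)))))))
  (↭-sym (shift (g x) (map f xs) _)))

module Cyclic (k : ℕ) where

  v : ℕ
  v = suc (k * 8)

  translate : ℕ → ℕ → ℕ
  translate t a = (a + t) % v

  translate< : ∀ t a → translate t a < v
  translate< t a = m%n<n (a + t) v

  untranslate : ℕ → ℕ → ℕ
  untranslate t y = (y + (v ∸ t % v)) % v

  untranslate-translate : ∀ t {a} → a < v → untranslate t (translate t a) ≡ a
  untranslate-translate t {a} a<v = begin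
    ((a + t) % v + s) % v                ≡⟨ cong (λ x → (x % v + s) % v) (cong (a +_) (m≡m%n+[m/n]*n t v)) ⟩
    ((a + (t % v + t / v * v)) % v + s) % v ≡⟨ cong (λ x → (x % v + s) % v) (+-assoc a (t % v) (t / v * v)) ⟨
    ((a + t % v + t / v * v) % v + s) % v ≡⟨ cong (λ x → (x + s) % v) ([m+kn]%n≡m%n (a + t % v) (t / v) v) ⟩
    ((a + t % v) % v + s) % v            ≡⟨ %-remove-inner (a + t % v) s ⟩
    (a + t % v + s) % v                  ≡⟨ cong (_% v)
        (trans (+-assoc a (t % v) s) (cong (a +_) (m+[n∸m]≡n (m%n≤n t v)))) ⟩
    (a + v) % v                          ≡⟨ [m+n]%n≡m%n a v ⟩
    a % v                                ≡⟨ m<n⇒m%n≡m a<v ⟩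
    a                                    ∎
    where
    open ≡-Reasoning
    s : ℕ
    s = v ∸ t % v
    %-remove-inner : ∀ x y → (x % v + y) % v ≡ (x + y) % v
    %-remove-inner x y = begin
      (x % v + y) % v                ≡⟨ %-distribˡ-+ (x % v) y v ⟩
      (x % v % v + y % v) % v        ≡⟨ cong (λ z → (z + y % v) % v) (m%n%n≡m%n x v) ⟩
      (x % v + y % v) % v            ≡⟨ %-distribˡ-+ x y v ⟨
      (x + y) % v                    ∎

  translate-injective : ∀ t {a b} → a < v → b < v → translate t a ≡ translate t b → a ≡ b
  translate-injective t a< b< eq = trans (sym (untranslate-translate t a<))
    (trans (cong (untranslate t) eq) (untranslate-translate t b<))

  translate-untranslate : ∀ a {x} → x < v → translate (untranslate a x) a ≡ x
  translate-untranslate a {x} x< = begin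
    (a + (x + (v ∸ a % v)) % v) % v         ≡⟨ %-distribˡ-+ a _ v ⟩
    (a % v + (x + (v ∸ a % v)) % v % v) % v ≡⟨ cong (λ z → (a % v + z) % v) (m%n%n≡m%n (x + (v ∸ a % v)) v) ⟩
    (a % v + (x + (v ∸ a % v)) % v) % v     ≡⟨ cong (λ z → (z + (x + (v ∸ a % v)) % v) % v) (m%n%n≡m%n a v) ⟨
    (a % v % v + (x + (v ∸ a % v)) % v) % v ≡⟨ %-distribˡ-+ (a % v) (x + (v ∸ a % v)) v ⟨
    (a % v + (x + (v ∸ a % v))) % v         ≡⟨ cong (_% v) (x+[y+z] (a % v) x (v ∸ a % v)) ⟩
    (x + (a % v + (v ∸ a % v))) % v         ≡⟨ cong (λ z → (x + z) % v) (m+[n∸m]≡n (m%n≤n a v)) ⟩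
    (x + v) % v                             ≡⟨ [m+n]%n≡m%n x v ⟩
    x % v                                   ≡⟨ m<n⇒m%n≡m x< ⟩
    x                                       ∎
    where
    open ≡-Reasoning
    x+[y+z] : ∀ x y z → x + (y + z) ≡ y + (x + z)
    x+[y+z] = solve-∀

  translate-+ : ∀ t a c → translate t (a + c) ≡ translate (translate t c) a
  translate-+ t a c = begin
    (a + c + t) % v                    ≡⟨ cong (_% v) (+-assoc a c t) ⟩
    (a + (c + t)) % v                  ≡⟨ %-distribˡ-+ a (c + t) v ⟩
    (a % v + (c + t) % v) % v          ≡⟨ cong (λ z → (a % v + z) % v) (m%n%n≡m%n (c + t) v) ⟨
    (a % v + (c + t) % v % v) % v      ≡⟨ %-distribˡ-+ a ((c + t) % v) v ⟨
    (a + (c + t) % v) % v              ∎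
    where open ≡-Reasoning

  rotation : ∀ c → map (λ t → translate t c) (upTo v) ↭ upTo v
  rotation c = Unique-covered⇒↭ (Unique.upTo⁺ v) covered
    (≤-reflexive (length-map (λ t → translate t c) (upTo v)))
    where
    covered : ∀ {x} → x ∈ upTo v → x ∈ map (λ t → translate t c) (upTo v)
    covered {x} x∈ = subst (_∈ map (λ t → translate t c) (upTo v)) (translate-untranslate c (∈-upTo⁻ x∈))
      (∈-map⁺ (λ t → translate t c) (∈-upTo⁺ (m%n<n (x + (v ∸ c % v)) v)))

  -- The translates of the edge a b. By `orbit-shift` and `orbit-flip` only the difference of a and
  -- b up to sign matters.
  orbit : ℕ → ℕ → List Edge
  orbit a b = map (λ t → translate t a , translate t b) (upTo v)

  orbit-flip : ∀ a b → orbit a b ≋ orbit b a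
  orbit-flip a b = flips (upTo v)
    where
    flips : ∀ ts → map (λ t → translate t a , translate t b) ts ≋ map (λ t → translate t b , translate t a) ts
    flips [] = ≋-refl
    flips (t ∷ ts) = ≋-flip (flips ts)

  orbit-shift : ∀ a b c → orbit (a + c) (b + c) ≋ orbit a b
  orbit-shift a b c = ↭⇒≋ (↭-trans
    (↭-reflexive (trans (map-cong (λ t → cong₂ _,_ (translate-+ t a c) (translate-+ t b c)) (upTo v))
        (map-∘ (upTo v))))
    (map-↭ (λ t → translate t a , translate t b) (rotation c)))

  translateQuad : (q : Quad) → All (_< v) (corners q) → ℕ → Quad
  translateQuad q@(quad a b c d u) q<v t = quad (translate t a) (translate t b) (translate t c) (translate t d)
    (Unique-map-on (λ x∈ y∈ → translate-injective t (All.lookup q<v x∈) (All.lookup q<v y∈)) u)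

  translates : (q : Quad) → All (_< v) (corners q) → List Quad
  translates q q<v = map (translateQuad q q<v) (upTo v)

  path-orbits : ∀ q q<v → concatMap pathEdges (translates q q<v) ≋
    orbit (Quad.a q) (Quad.b q) ++ orbit (Quad.b q) (Quad.c q) ++ orbit (Quad.c q) (Quad.d q)
  path-orbits q q<v = ↭⇒≋ (↭-trans (↭-reflexive (concatMap-map pathEdges (translateQuad q q<v) (upTo v)))
    (concatMap-triple (upTo v)))

  -- The differences of consecutive corners are 4i+1, 4i+2, 4i+3, 4i+4.
  baseQuad : ℕ → Quad
  baseQuad i = quad (4 + i * 4) (5 + i * 8) (3 + i * 4) 0
    ((<⇒≢ (+-mono-≤ {5} ≤-refl 4i≤8i) ∷ >⇒≢ ≤-refl ∷ (λ ()) ∷ []) ∷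
     (>⇒≢ (+-mono-≤ {4} {5} (n≤1+n 4) 4i≤8i) ∷ (λ ()) ∷ []) ∷ ((λ ()) ∷ []) ∷ [] ∷ [])
    where
    4i≤8i : i * 4 ≤ i * 8
    4i≤8i = *-monoʳ-≤ i (from-yes (4 ≤? 8))

  baseQuad< : ∀ {i} → i < k → All (_< v) (corners (baseQuad i))
  baseQuad< {i} i<k = below (from-yes (4 ≤? 8)) 4i≤8i ∷ below (from-yes (5 ≤? 8)) ≤-refl ∷ below
      (from-yes (3 ≤? 8)) 4i≤8i ∷ z<s ∷ []
    where
    4i≤8i : i * 4 ≤ i * 8
    4i≤8i = *-monoʳ-≤ i (from-yes (4 ≤? 8))
    below : ∀ {m j} → m ≤ 8 → j ≤ i * 8 → m + j < v
    below m≤8 j≤ = s≤s (≤-trans (+-mono-≤ m≤8 j≤) (*-monoˡ-≤ 8 i<k))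

  blocksBelow : ∀ j → j ≤ k → List Quad
  blocksBelow zero _ = []
  blocksBelow (suc j) j<k = translates (baseQuad j) (baseQuad< j<k) ++ blocksBelow j (<⇒≤ j<k)

  orbitsBelow : ℕ → List Edge
  orbitsBelow zero = []
  orbitsBelow (suc j) = orbit (4 + j * 4) (5 + j * 8) ++ orbitsBelow j

  cut-blocks : ∀ j j≤k → map cutEdge (blocksBelow j j≤k) ≡ orbitsBelow j
  cut-blocks zero _ = refl
  cut-blocks (suc j) j<k = trans (map-++ cutEdge (translates (baseQuad j) (baseQuad< j<k)) _)
    (cong₂ _++_ (sym (map-∘ (upTo v))) (cut-blocks j (<⇒≤ j<k)))

  length-blocks : ∀ j j≤k → length (blocksBelow j j≤k) ≡ j * v
  length-blocks zero _ = refl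
  length-blocks (suc j) j<k = trans (length-++ (translates (baseQuad j) (baseQuad< j<k)))
    (cong₂ _+_ (trans (length-map (translateQuad (baseQuad j) (baseQuad< j<k)) (upTo v)) (length-upTo v))
        (length-blocks j (<⇒≤ j<k)))

  blocks : List Quad
  blocks = blocksBelow k ≤-refl

  block-orbit : ∀ {i a b} j j≤k → i < j → (a , b) ∈ arcs (cycleEdges (baseQuad i)) →
    ∀ {t} → t < v → (translate t a , translate t b) ∈ concatMap (arcs ∘ cycleEdges) (blocksBelow j j≤k)
  block-orbit {i} {a} {b} (suc j) j<k i≤j ab∈ {t} t<v with i ≟ j
  ... | yes refl = subst ((translate t a , translate t b) ∈_)
      (sym (concatMap-++ (arcs ∘ cycleEdges) (translates (baseQuad j) (baseQuad< j<k)) _))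
    (∈-++⁺ˡ (∈-concatMap⁺ (arcs ∘ cycleEdges)
        (lose (∈-map⁺ (translateQuad (baseQuad j) (baseQuad< j<k)) (∈-upTo⁺ t<v))
      (∈-map⁺ (onEdges (translate t)) ab∈))))
  ... | no i≢j = subst ((translate t a , translate t b) ∈_)
      (sym (concatMap-++ (arcs ∘ cycleEdges) (translates (baseQuad j) (baseQuad< j<k)) _))
    (∈-++⁺ʳ _ (block-orbit j (<⇒≤ j<k) (≤∧≢⇒< (≤-pred i≤j) i≢j) ab∈ t<v))

  difference-edge : ∀ i (r : Fin 4) → ∃ λ a → (a , suc (Fin.toℕ r) + i * 4 + a) ∈ arcs (cycleEdges (baseQuad i))
  difference-edge i zero = 4 + i * 4 , subst (λ b → (4 + i * 4 , b) ∈ arcs (cycleEdges (baseQuad i))) (eq i)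
      (here refl)
    where
    eq : ∀ i → 5 + i * 8 ≡ 1 + i * 4 + (4 + i * 4)
    eq = solve-∀
  difference-edge i (suc zero) = 3 + i * 4 , subst (λ b → (3 + i * 4 , b) ∈ arcs (cycleEdges (baseQuad i))) (eq i)
      (there (there (there (here refl))))
    where
    eq : ∀ i → 5 + i * 8 ≡ 2 + i * 4 + (3 + i * 4)
    eq = solve-∀
  difference-edge i (suc (suc zero)) = 0 , subst (λ b → (0 , b) ∈ arcs (cycleEdges (baseQuad i)))
      (sym (+-identityʳ _)) (there (there (there (there (there (here refl))))))
  difference-edge i (suc (suc (suc zero))) = 0 , subst (λ b → (0 , b) ∈ arcs (cycleEdges (baseQuad i)))
      (sym (+-identityʳ _)) (there (there (there (there (there (there (here refl)))))))

  -- The difference d + 1 occurs in base cycle d / 4, on the edge numbered d % 4; that edge is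
  -- translated so as to start at x.
  short-arc : ∀ {d x} → d < k * 4 → x < v → (x , translate x (suc d)) ∈ concatMap (arcs ∘ cycleEdges) blocks
  short-arc {d} {x} d<4k x<v with difference-edge (d / 4) (Fin.fromℕ< (m%n<n d 4))
  ... | a , ab∈ = subst (_∈ concatMap (arcs ∘ cycleEdges) blocks) (cong₂ _,_ at-a at-b)
      (block-orbit k ≤-refl (m<n*o⇒m/o<n d<4k) ab∈ (m%n<n (x + (v ∸ a % v)) v))
    where
    t : ℕ
    t = untranslate a x
    at-a : translate t a ≡ x
    at-a = translate-untranslate a x<v
    d≡ : suc (Fin.toℕ (Fin.fromℕ< (m%n<n d 4))) + d / 4 * 4 ≡ suc d
    d≡ = cong suc (trans (cong (_+ d / 4 * 4) (toℕ-fromℕ< (m%n<n d 4))) (sym (m≡m%n+[m/n]*n d 4)))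
    at-b : translate t (suc (Fin.toℕ (Fin.fromℕ< (m%n<n d 4))) + d / 4 * 4 + a) ≡ translate x (suc d)
    at-b = trans (cong (λ e → translate t (e + a)) d≡)
        (trans (translate-+ t (suc d) a) (cong (λ y → translate y (suc d)) at-a))

  -- Of the differences y - x and v - (y - x) one is at most 4 k, as they add up to 8 k + 1.
  increasing-arc : ∀ {x y} → x < y → y < v → (x , y) ∈ concatMap (arcs ∘ cycleEdges) blocks ⊎ (y , x) ∈ concatMap
      (arcs ∘ cycleEdges) blocks
  increasing-arc {x} {y} x<y y<v with y ∸ suc x <? k * 4
  ... | yes short = inj₁ (subst (λ z → (x , z) ∈ concatMap (arcs ∘ cycleEdges) blocks) wrap
      (short-arc short (<-trans x<y y<v)))
    where
    wrap : translate x (suc (y ∸ suc x)) ≡ y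
    wrap = trans (cong (_% v) (trans (sym (+-suc (y ∸ suc x) x)) (m∸n+n≡m x<y))) (m<n⇒m%n≡m y<v)
  ... | no long = inj₂ (subst (λ z → (y , z) ∈ concatMap (arcs ∘ cycleEdges) blocks) wrap (short-arc short y<v))
    where
    -- `suc d` is v - (y - x), the difference on the way from y past v to x.
    d : ℕ
    d = k * 8 ∸ (y ∸ x)
    y∸x≤ : y ∸ x ≤ k * 8
    y∸x≤ = ≤-trans (m∸n≤m y x) (≤-pred y<v)
    4k< : k * 4 < y ∸ x
    4k< = subst (k * 4 <_) (sym (+-∸-assoc 1 x<y)) (s≤s (≮⇒≥ long))
    short : d < k * 4
    short = +-cancelʳ-< (y ∸ x) d (k * 4) (subst (_< k * 4 + (y ∸ x)) (sym (m∸n+n≡m y∸x≤))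
      (subst (_< k * 4 + (y ∸ x)) (sym (*-distribˡ-+ k 4 4)) (+-monoʳ-< (k * 4) 4k<)))
    wrap : translate y (suc d) ≡ x
    wrap = begin
      (suc d + y) % v                ≡⟨ cong (λ z → (suc d + z) % v) (m∸n+n≡m (<⇒≤ x<y)) ⟨
      (suc d + (y ∸ x + x)) % v      ≡⟨ cong (_% v) (+-assoc (suc d) (y ∸ x) x) ⟨
      (suc (d + (y ∸ x)) + x) % v    ≡⟨ cong (λ z → (suc z + x) % v) (m∸n+n≡m y∸x≤) ⟩
      (v + x) % v                    ≡⟨ cong (_% v) (+-comm v x) ⟩
      (x + v) % v                    ≡⟨ [m+n]%n≡m%n x v ⟩
      x % v                          ≡⟨ m<n⇒m%n≡m (<-trans x<y y<v) ⟩
      x                              ∎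
      where open ≡-Reasoning

  triangle-v : ∀ j → triangle (suc (j * 8)) ≡ j * suc (j * 8) * 4
  triangle-v zero = refl
  triangle-v (suc j) = trans (triangle-8+ (suc (j * 8)))
      (trans (cong (4 * (2 * suc (j * 8) + 7) +_) (triangle-v j)) (step j))
    where
    step : ∀ j → 4 * (2 * suc (j * 8) + 7) + j * suc (j * 8) * 4 ≡ suc j * (9 + j * 8) * 4
    step = solve-∀

  -- Every edge is covered, and the k v cycles have no more edges in total than the complete graph,
  -- so none is covered twice.
  blocks-≋ : pairs (upTo v) ≋ concatMap cycleEdges blocks
  blocks-≋ = ≋-sym (mk≋ (Unique-covered⇒↭ (Unique-arcs-pairs (Unique.upTo⁺ v)) covered (≤-reflexive count)))
    where
    open ≡-Reasoning
    to-arcs : ∀ {e} → e ∈ concatMap (arcs ∘ cycleEdges) blocks → e ∈ arcs (concatMap cycleEdges blocks)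
    to-arcs = subst (_ ∈_) (sym (arcs-concatMap cycleEdges blocks))
    covered : ∀ {e} → e ∈ arcs (pairs (upTo v)) → e ∈ arcs (concatMap cycleEdges blocks)
    covered {x , y} e∈ with ∈-arcs-pairs⁻ {upTo v} (Unique.upTo⁺ v) e∈
    ... | x∈ , y∈ , x≢y with <-cmp x y
    ...   | tri≈ _ x≡y _ = contradiction x≡y x≢y
    ...   | tri< x<y _ _ = [ to-arcs , ∈-arcs-sym {concatMap cycleEdges blocks} ∘ to-arcs ]′
        (increasing-arc x<y (∈-upTo⁻ y∈))
    ...   | tri> _ _ y<x = [ ∈-arcs-sym {concatMap cycleEdges blocks} ∘ to-arcs , to-arcs ]′
        (increasing-arc y<x (∈-upTo⁻ x∈))
    count : length (arcs (concatMap cycleEdges blocks)) ≡ length (arcs (pairs (upTo v)))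
    count = begin
      length (arcs (concatMap cycleEdges blocks))   ≡⟨ length-arcs (concatMap cycleEdges blocks) ⟩
      2 * length (concatMap cycleEdges blocks)      ≡⟨ cong (2 *_)
          (length-concatMap cycleEdges 4 (λ _ → refl) blocks) ⟩
      2 * (length blocks * 4)                       ≡⟨ cong (λ n → 2 * (n * 4)) (length-blocks k ≤-refl) ⟩
      2 * (k * v * 4)                               ≡⟨ cong (2 *_) (triangle-v k) ⟨
      2 * triangle v                                ≡⟨ cong (λ n → 2 * triangle n) (length-upTo v) ⟨
      2 * triangle (length (upTo v))                ≡⟨ cong (2 *_) (length-pairs (upTo v)) ⟨
      2 * length (pairs (upTo v))                   ≡⟨ length-arcs (pairs (upTo v)) ⟨
      length (arcs (pairs (upTo v)))                ∎

-- Paths through the cut edges of the cyclic design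

concatMap-pair : {f g : A → B} (xs : List A) → concatMap (λ x → f x ∷ g x ∷ []) xs ↭ map f xs ++ map g xs
concatMap-pair [] = ↭-refl
concatMap-pair {f = f} {g} (x ∷ xs) = prep (f x) (↭-trans (prep (g x) (concatMap-pair xs))
  (↭-sym (shift (g x) (map f xs) (map g xs))))

concatMap-concatMap : {C : Set} (g : B → List C) (f : A → List B) (xs : List A) →
  concatMap g (concatMap f xs) ≡ concatMap (concatMap g ∘ f) xs
concatMap-concatMap g f [] = refl
concatMap-concatMap g f (x ∷ xs) = trans (concatMap-++ g (f x) (concatMap f xs))
    (cong (concatMap g (f x) ++_) (concatMap-concatMap g f xs))

tripled : ℕ → List ℕ
tripled j = j * 3 ∷ 1 + j * 3 ∷ 2 + j * 3 ∷ []

concatMap-tripled : ∀ u → concatMap tripled (upTo u) ↭ upTo (u * 3)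
concatMap-tripled u = Unique-covered⇒↭ (Unique.upTo⁺ (u * 3)) covered
  (≤-reflexive (trans (length-concatMap tripled 3 (λ _ → refl) (upTo u))
      (trans (cong (_* 3) (length-upTo u)) (sym (length-upTo (u * 3))))))
  where
  member : ∀ z → z ∈ tripled (z / 3)
  member z with z % 3 | m%n<n z 3 | m≡m%n+[m/n]*n z 3
  ... | 0 | _ | eq = here eq
  ... | 1 | _ | eq = there (here eq)
  ... | 2 | _ | eq = there (there (here eq))
  ... | suc (suc (suc _)) | s≤s (s≤s (s≤s ())) | _
  covered : ∀ {z} → z ∈ upTo (u * 3) → z ∈ concatMap tripled (upTo u)
  covered {z} z∈ = ∈-concatMap⁺ tripled {upTo u} (lose (∈-upTo⁺ (m<n*o⇒m/o<n (∈-upTo⁻ {u * 3} z∈))) (member z))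

module CyclicPaths (k : ℕ) where
  open Cyclic k

  cyclic-design : 1 ≤ k → ∀ {W} → Unique (W ++ upTo v) →
    Decomposable (orbitsBelow k ++ pairs W ++ join W (upTo v)) → ℒ₁ C₄ v (length W + v)
  cyclic-design 1≤k {W} u rest = subst₂ (ℒ₁ C₄) (length-upTo v)
      (trans (length-++ W) (cong (length W +_) (length-upTo v)))
    (listed-design {upTo v} {W} (Unique.upTo⁺ v)
        (subst (1 <_) (sym (length-upTo v)) (s≤s (≤-trans 1≤k (m≤m*n k 8)))) blocks blocks-≋ u
      (subst (λ E → Decomposable (E ++ pairs W ++ join W (upTo v))) (sym (cut-blocks k ≤-refl)) rest))

  cut-orbit : ∀ i → orbit (4 + i * 4) (5 + i * 8) ≋ orbit 0 (1 + i * 4)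
  cut-orbit i = subst (λ b → orbit (4 + i * 4) b ≋ orbit 0 (1 + i * 4)) (eq i)
      (orbit-shift 0 (1 + i * 4) (4 + i * 4))
    where
    eq : ∀ i → 1 + i * 4 + (4 + i * 4) ≡ 5 + i * 8
    eq = solve-∀

  -- Successive differences are 4i+1, −(4i+5) and 4i+9, up to sign the differences cut from blocks i, i+1, i+2.
  zigzag : ℕ → Quad
  zigzag i = quad 4 (5 + i * 4) 0 (9 + i * 4)
    (((λ ()) ∷ (λ ()) ∷ (λ ()) ∷ []) ∷ ((λ ()) ∷ <⇒≢ (+-monoˡ-< (i * 4) (from-yes (5 <? 9))) ∷ []) ∷
        ((λ ()) ∷ []) ∷ [] ∷ [])

  zigzag< : ∀ {i} → 3 + i ≤ k → All (_< v) (corners (zigzag i))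
  zigzag< {i} 3+i≤k = below (m≤m+n 4 (5 + i * 4)) ∷ below (+-monoˡ-≤ (i * 4) (from-yes (5 ≤? 9))) ∷ z<s ∷
      below ≤-refl ∷ []
    where
    below : ∀ {x} → x ≤ 9 + i * 4 → x < v
    below x≤ = s≤s (≤-trans x≤ (≤-trans (+-mono-≤ {9} {24} (from-yes (9 ≤? 24)) (*-monoʳ-≤ i (from-yes (4 ≤? 8))))
        (*-monoˡ-≤ 8 3+i≤k)))

  zigzag-orbits : ∀ {i} → 3 + i ≤ k → Decomposable
    (orbit (4 + (2 + i) * 4) (5 + (2 + i) * 8) ++ orbit (4 + (1 + i) * 4) (5 + (1 + i) * 8) ++ orbit (4 + i * 4)
        (5 + i * 8))
  zigzag-orbits {i} 3+i≤k = translates (zigzag i) (zigzag< 3+i≤k) , ≋-sym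
      (≋-trans (path-orbits (zigzag i) (zigzag< 3+i≤k))
    (≋-trans
      (≋-++ (≋-trans first (≋-sym (cut-orbit i)))
          (≋-++ (≋-trans (orbit-flip (5 + i * 4) 0) (≋-sym (cut-orbit (1 + i)))) (≋-sym (cut-orbit (2 + i)))))
      (solve 3 (λ a b c → (a ⊕ (b ⊕ c)) ⊜ (c ⊕ (b ⊕ a))) ≋-refl
        (orbit (4 + i * 4) (5 + i * 8)) (orbit (4 + (1 + i) * 4) (5 + (1 + i) * 8))
            (orbit (4 + (2 + i) * 4) (5 + (2 + i) * 8)))))
    where
    first : orbit 4 (5 + i * 4) ≋ orbit 0 (1 + i * 4)
    first = subst (λ b → orbit 4 b ≋ orbit 0 (1 + i * 4)) (+-comm (1 + i * 4) 4) (orbit-shift 0 (1 + i * 4) 4)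

  orbits-mod-3 : ∀ m {r} → m * 3 + r ≤ k → ∃ λ ps → orbitsBelow (m * 3 + r) ≋ concatMap pathEdges ps ++
      orbitsBelow r
  orbits-mod-3 zero _ = [] , ≋-refl
  orbits-mod-3 (suc m) {r} ≤k =
    let ps , ps≋ = zigzag-orbits ≤k
        qs , qs≋ = orbits-mod-3 m (≤-trans (m≤n+m (m * 3 + r) 3) ≤k)
    in ps ++ qs , ≋-trans
      (solve 4 (λ a b c d → (a ⊕ (b ⊕ (c ⊕ d))) ⊜ ((a ⊕ (b ⊕ c)) ⊕ d)) ≋-refl
        (orbit (4 + (2 + i m r) * 4) (5 + (2 + i m r) * 8)) (orbit (4 + (1 + i m r) * 4) (5 + (1 + i m r) * 8))
            (orbit (4 + i m r * 4) (5 + i m r * 8)) (orbitsBelow (i m r)))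
      (≋-trans (≋-++ ps≋ qs≋) (≡⇒≋ (trans
          (sym (++-assoc (concatMap pathEdges ps) (concatMap pathEdges qs) (orbitsBelow r)))
        (cong (_++ orbitsBelow r) (sym (concatMap-++ pathEdges ps qs))))))
    where
    i : ℕ → ℕ → ℕ
    i m r = m * 3 + r

  reduce-mod-3 : ∀ {m r E} → k ≡ m * 3 + r → Decomposable (orbitsBelow r ++ E) → Decomposable (orbitsBelow k ++ E)
  reduce-mod-3 {m} {r} {E} k≡ rest =
    let ps , ps≋ = orbits-mod-3 m {r} (≤-reflexive (sym k≡)) in
    subst (λ j → Decomposable (orbitsBelow j ++ E)) (sym k≡)
      (Decomposable-≋ (≋-trans (≋-++ ps≋ (≋-refl {E})) (≡⇒≋ (++-assoc (concatMap pathEdges ps) (orbitsBelow r) E)))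
        (Decomposable-++ (ps , ≋-refl) rest))

  apex-unique : Unique ([ v ] ++ upTo v)
  apex-unique = All.tabulate (λ x∈ → ≢-sym (<⇒≢ (∈-upTo⁻ x∈))) ∷ Unique.upTo⁺ v

  v≢translate : ∀ t a → v ≢ translate t a
  v≢translate t a = ≢-sym (<⇒≢ (translate< t a))

  -- The freedom in c lines the spokes up with the translates of any chosen point, so that they can
  -- be attached to translated paths.
  spokes : ∀ c → join [ v ] (upTo v) ≋ map (λ t → v , translate t c) (upTo v)
  spokes c = ≋-trans (≡⇒≋ (join-[-] v (upTo v))) (≋-sym (↭⇒≋
    (↭-trans (↭-reflexive (map-∘ (upTo v))) (map-↭ (v ,_) (rotation c)))))

  k≡0⇒v : ∀ {m} → 1 ≤ k → k ≡ m * 3 + 0 → ℒ₁ C₄ v v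
  k≡0⇒v {m} 1≤k k≡ = cyclic-design 1≤k {[]} (Unique.upTo⁺ v)
      (reduce-mod-3 {m} {0} k≡ ([] , ≡⇒≋ (join-[] (upTo v))))

  -- Left over are the orbits of differences 1 and 5 and the v spokes. The translates of the path
  -- from the new vertex through 1 and 0 to 5 use each of the three once.
  k≡2⇒1+v : ∀ {m} → k ≡ m * 3 + 2 → ℒ₁ C₄ v (1 + v)
  k≡2⇒1+v {m} k≡ = cyclic-design (subst (1 ≤_) (sym k≡) (≤-trans (s≤s z≤n) (m≤n+m 2 (m * 3)))) {[ v ]} apex-unique
      (reduce-mod-3 {m} {2} k≡
    (map apexPath (upTo v) , ≋-trans
      (≋-trans (≋-++ {orbitsBelow 2} {orbit 0 5 ++ orbit 1 0}
          (≋-++ (cut-orbit 1) (≋-trans (≡⇒≋ (++-identityʳ _)) (≋-trans (cut-orbit 0) (orbit-flip 0 1))))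
              (spokes 1))
        (solve 3 (λ a b c → ((a ⊕ b) ⊕ c) ⊜ (c ⊕ (b ⊕ a))) ≋-refl (orbit 0 5) (orbit 1 0)
            (map (λ t → v , translate t 1) (upTo v))))
      (≋-sym (↭⇒≋ (↭-trans (↭-reflexive (concatMap-map pathEdges apexPath (upTo v)))
          (concatMap-triple (upTo v)))))))
    where
    5<v : 5 < v
    5<v = s≤s (≤-trans (from-yes (5 ≤? 16)) (*-monoˡ-≤ 8 (subst (2 ≤_) (sym k≡) (m≤n+m 2 (m * 3)))))
    base : Unique (1 ∷ 0 ∷ 5 ∷ [])
    base = ((λ ()) ∷ (λ ()) ∷ []) ∷ ((λ ()) ∷ []) ∷ [] ∷ []
    base< : All (_< v) (1 ∷ 0 ∷ 5 ∷ [])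
    base< = ≤-trans (s≤s (s≤s z≤n)) 5<v ∷ z<s ∷ 5<v ∷ []
    apexPath : ℕ → Quad
    apexPath t = quad v (translate t 1) (translate t 0) (translate t 5)
      ((v≢translate t 1 ∷ v≢translate t 0 ∷ v≢translate t 5 ∷ []) ∷
       Unique-map-on (λ x∈ y∈ → translate-injective t (All.lookup base< x∈) (All.lookup base< y∈)) base)

  module _ {m : ℕ} (k≡ : k ≡ m * 3 + 1) where

    1≤k : 1 ≤ k
    1≤k = subst (1 ≤_) (sym k≡) (m≤n+m 1 (m * 3))

    -- v = 24 m + 9 is a multiple of 3, so the one remaining orbit, a Hamiltonian cycle of steps by
    -- 1, can be cut into runs of three edges.
    triples : concatMap tripled (upTo (3 + m * 8)) ↭ upTo v
    triples = subst (λ n → concatMap tripled (upTo (3 + m * 8)) ↭ upTo n)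
        (trans (eq m) (cong (λ j → suc (j * 8)) (sym k≡))) (concatMap-tripled (3 + m * 8))
      where
      eq : ∀ m → (3 + m * 8) * 3 ≡ suc ((m * 3 + 1) * 8)
      eq = solve-∀

    four : Quad
    four = quad 0 1 2 3 (Unique.upTo⁺ 4)

    four< : All (_< v) (corners four)
    four< = All.map (λ x<9 → ≤-trans x<9 (s≤s (*-monoˡ-≤ 8 1≤k))) (from-yes (All.all? (_<? 9) (corners four)))

    rim : ℕ → Quad
    rim t = translateQuad four four< t

    step spoke : ℕ → Edge
    step t = translate t 0 , translate t 1
    spoke t = v , translate t 0

    k≡1⇒v : ℒ₁ C₄ v v
    k≡1⇒v = cyclic-design 1≤k {[]} (Unique.upTo⁺ v) (reduce-mod-3 {m} {1} k≡
      (map (rim ∘ (_* 3)) (upTo (3 + m * 8)) , ≋-trans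
        (≋-trans (≋-++ {orbitsBelow 1} {orbit 0 1} (≋-trans (≡⇒≋ (++-identityʳ _)) (cut-orbit 0))
            (≡⇒≋ (join-[] (upTo v)))) (≡⇒≋ (++-identityʳ _)))
        (≋-sym (↭⇒≋ (↭-trans (↭-reflexive
            (trans (concatMap-map pathEdges (rim ∘ (_* 3)) (upTo (3 + m * 8)))
                (sym (map-concatMap step tripled (upTo (3 + m * 8))))))
          (map-↭ step triples))))))

    -- With the new vertex as hub the remaining edges form a wheel. It falls into pieces of three
    -- consecutive rim edges and the spokes at their first ends, and each piece is a union of two
    -- paths.
    wheelPaths : ℕ → List Quad
    wheelPaths t =
      quad v (translate t 0) (translate t 1) (translate t 2)
        ((v≢translate t 0 ∷ v≢translate t 1 ∷ v≢translate t 2 ∷ []) ∷ Unique.take⁺ 3 (Quad.distinct (rim t))) ∷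
      quad (translate t 1) v (translate t 2) (translate t 3) (Unique-resp-↭ (swap _ _ ↭-refl)
        ((v≢translate t 1 ∷ v≢translate t 2 ∷ v≢translate t 3 ∷ []) ∷ Unique.drop⁺ 1 (Quad.distinct (rim t)))) ∷ []

    wheel : ℕ → List Edge
    wheel t = step t ∷ spoke t ∷ []

    wheelPaths-≋ : ∀ j → concatMap pathEdges (wheelPaths (j * 3)) ≋ concatMap wheel (tripled j)
    wheelPaths-≋ j = ≋-trans (↭⇒≋ (swap _ _ (prep _ (prep _ (swap _ _ ↭-refl)))))
      (≋-++ (≋-refl {_ ∷ _ ∷ _ ∷ []}) (≋-flip ≋-refl))

    k≡1⇒1+v : ℒ₁ C₄ v (1 + v)
    k≡1⇒1+v = cyclic-design 1≤k {[ v ]} apex-unique (reduce-mod-3 {m} {1} k≡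
      (concatMap (wheelPaths ∘ (_* 3)) (upTo (3 + m * 8)) , ≋-trans
        (≋-++ {orbitsBelow 1} {orbit 0 1} (≋-trans (≡⇒≋ (++-identityʳ _)) (cut-orbit 0)) (spokes 0))
        (≋-sym (≋-trans (≡⇒≋ (concatMap-concatMap pathEdges (wheelPaths ∘ (_* 3)) (upTo (3 + m * 8))))
          (≋-trans (≋-concatMap wheelPaths-≋ (upTo (3 + m * 8)))
            (≋-trans (≡⇒≋ (sym (concatMap-concatMap wheel tripled (upTo (3 + m * 8)))))
              (↭⇒≋ (↭-trans (concatMap-↭ wheel triples) (concatMap-pair (upTo v))))))))))

-- Since 8 k + 1 + e must not be 2 mod 3, the pairs (k mod 3, e) that occur are (0, 0), (1, 0), (1,
-- 1) and (2, 1).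
near-order : ∀ k e → 1 ≤ k → e < 2 → 01Mod3 (e + suc (k * 8)) → ℒ₁ C₄ (suc (k * 8)) (e + suc (k * 8))
near-order k e 1≤k e<2 n%3 = cases (k % 3) (m%n<n k 3) (k / 3)
    (trans (m≡m%n+[m/n]*n k 3) (+-comm (k % 3) (k / 3 * 3))) e e<2 n%3
  where
  residue : ∀ {r} m e → k ≡ m * 3 + r → (e + suc (k * 8)) % 3 ≡ (e + suc (r * 8)) % 3
  residue {r} m e refl = trans (cong (_% 3) (eq m r e)) ([m+kn]%n≡m%n (e + suc (r * 8)) (m * 8) 3)
    where
    eq : ∀ m r e → e + suc ((m * 3 + r) * 8) ≡ e + suc (r * 8) + m * 8 * 3
    eq = solve-∀
  excluded : ∀ r m e → (e + suc (r * 8)) % 3 ≡ 2 → k ≡ m * 3 + r → ¬ 01Mod3 (e + suc (k * 8))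
  excluded r m e ≡2 k≡ n%3 = two≢ (subst (λ x → x ≡ 0 ⊎ x ≡ 1) (trans (residue m e k≡) ≡2) n%3)
  cases : ∀ r → r < 3 → ∀ m → k ≡ m * 3 + r → ∀ e → e < 2 → 01Mod3 (e + suc (k * 8)) → ℒ₁ C₄ (suc (k * 8))
      (e + suc (k * 8))
  cases 0 _ m k≡ 0 _ _ = CyclicPaths.k≡0⇒v k {m} 1≤k k≡
  cases 1 _ m k≡ 0 _ _ = CyclicPaths.k≡1⇒v k {m} k≡
  cases 1 _ m k≡ 1 _ _ = CyclicPaths.k≡1⇒1+v k {m} k≡
  cases 2 _ m k≡ 1 _ _ = CyclicPaths.k≡2⇒1+v k {m} k≡
  cases 0 _ m k≡ 1 _ n%3 = contradiction n%3 (excluded 0 m 1 refl k≡)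
  cases 2 _ m k≡ 0 _ n%3 = contradiction n%3 (excluded 2 m 0 refl k≡)
  cases (suc (suc (suc _))) (s≤s (s≤s (s≤s ())))
  cases _ _ _ _ (suc (suc _)) (s≤s (s≤s ()))

theorem4p4 : ∀ (v : ℕ) → v > 1 → DesignOfOrder C₄ v →
    (ℒ₁ C₄ v ≐ AtLeast01Mod3 v)
    × (AtLeast01Mod3 (v + 2) ⊆ ℒ₂ C₄ v)
    × (ℒ₂ C₄ v ⊆ AtLeast01Mod3 v)
theorem4p4 v v>1 𝓓 =
    ((λ (𝓑 , 𝓑′ , link) → downLink⇒≤ v>1 𝓑 𝓑′ link , P₄-order 𝓑′) , realise)
  , (λ (v+2≤n , n%3) 𝓑 → downLink-v+2≤ v>1 𝓑 v+2≤n n%3)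
  , (λ every → let 𝓑′ , link = every 𝓓 in downLink⇒≤ v>1 𝓓 𝓑′ link , P₄-order 𝓑′)
  where
  k : ℕ
  k = v / 8
  v≡ : v ≡ suc (k * 8)
  v≡ = trans (m≡m%n+[m/n]*n v 8) (cong (_+ k * 8) (C₄-order (<-trans z<s v>1) 𝓓))
  1≤k : 1 ≤ k
  1≤k = *-cancelʳ-≤ 1 k 8 (≤-pred (subst (9 ≤_) v≡ (C₄-order≥9 v>1 𝓓)))
  realise : ∀ {n} → AtLeast01Mod3 v n → ℒ₁ C₄ v n
  realise {n} (v≤n , n%3) with n ∸ v <? 2
  ... | yes e<2 = subst₂ (ℒ₁ C₄) (sym v≡) n≡ (near-order k (n ∸ v) 1≤k e<2 (subst 01Mod3 (sym n≡) n%3))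
    where
    n≡ : n ∸ v + suc (k * 8) ≡ n
    n≡ = trans (cong (n ∸ v +_) (sym v≡)) (m∸n+n≡m v≤n)
  -- From v + 2 on every design can be linked, so the given one serves as witness.
  ... | no e≮2 = 𝓓 , downLink-v+2≤ v>1 𝓓 (subst (v + 2 ≤_) (m+[n∸m]≡n v≤n) (+-monoʳ-≤ v (≮⇒≥ e≮2))) n%3
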